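{- Let $k=4$ and $r_1\ge r_2\ge r_3\ge r_4\ge 1$. If $(r_1-1)< (r_2-1)+(r_3-1)-(r_4-1)$, then the arithmetic mean component competitive ratio for the 4-objective time series search problem is $$z_f^4=\frac18\left[\sqrt{4r_3+\{(r_1-1)-(r_2-1)+(r_4-1)\}^2}+(r_1+1)+(r_2+1)+(r_4+1)\right].$$
   Context: For an integer $k\ge 2$ and reals $0<m_i\le M_i$ ($1\le i\le k$), let $r_i=M_i/m_i$ be the fluctuation ratio of the price interval $[m_i,M_i]$ of the $i$th objective. It is assumed throughout that $r_1\ge\cdots\ge r_k\ge 1$. The arithmetic mean component competitive ratio of the $k$-objective time series search problem is the quantity $$z_f^k=\sup_{(x_1,\ldots,x_k)\in\mathcal{S}_f^k}\frac1k\left(\frac{M_1}{x_1}+\cdots+\frac{M_k}{x_k}\right),$$ where $$\mathcal{S}_f^k=\left\{(x_1,\ldots,x_k)\in[m_1,M_1]\times\cdots\times[m_k,M_k] : \frac1k\sum_{i=1}^k\frac{x_i}{m_i}=\frac1k\sum_{i=1}^k\frac{M_i}{x_i}\right\}.$$ -}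

module Defs where

open import Data.Empty using (⊥-elim)
open import Data.Fin.Base using (Fin)
open import Data.Integer.Base as ℤ using (+_)
import Data.Integer.Properties as ℤ
open import Data.Nat.Base as ℕ using (ℕ; zero; suc; NonTrivial; nonTrivial⇒nonZero)
import Data.Nat.Properties as ℕ
open import Data.Product.Base using (∃; _×_; _,_)
open import Data.Rational.Base as ℚ using (ℚ; 0ℚ; 1ℚ; ½; ∣_∣; ↥_; ↧ₙ_; mkℚ)
import Data.Rational.Properties as ℚ
open import Data.Rational.Solver using (module +-*-Solver)
import Data.Rational.Unnormalised.Base as ℚᵘ
import Data.Rational.Unnormalised.Properties as ℚᵘ
open import Data.Sum.Base using (_⊎_; inj₁; inj₂)
open import Data.Vec.Functional using (foldr)
open import Relation.Binary.PropositionalEquality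
  using (_≡_; _≢_; refl; sym; trans; cong; cong₂; subst; subst₂)
open import Relation.Nullary using (yes; no; contradiction)

open +-*-Solver using (solve; _:+_; _:*_; _:-_; :-_; _:=_; con)

private
  variable
    p q ε δ : ℚ

abstract

  ½-pos : 0ℚ ℚ.< ε → 0ℚ ℚ.< ε ℚ.* ½
  ½-pos {ε} 0<ε = subst (ℚ._< ε ℚ.* ½) (ℚ.*-zeroˡ ½) (ℚ.*-monoˡ-<-pos ½ 0<ε)

  ½+½ : ∀ ε → ε ℚ.* ½ ℚ.+ ε ℚ.* ½ ≡ ε
  ½+½ ε = trans (sym (ℚ.*-distribˡ-+ ε ½ ½)) (ℚ.*-identityʳ ε)

  *-pos : 0ℚ ℚ.< p → 0ℚ ℚ.< q → 0ℚ ℚ.< p ℚ.* q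
  *-pos {p} {q} 0<p 0<q =
    subst (ℚ._< p ℚ.* q) (ℚ.*-zeroˡ q) (ℚ.*-monoˡ-<-pos q {{ℚ.positive 0<q}} 0<p)

  *-mono-≤ : ∀ {p p′ q q′} → 0ℚ ℚ.≤ p → p ℚ.≤ p′ → 0ℚ ℚ.≤ q → q ℚ.≤ q′ → p ℚ.* q ℚ.≤ p′ ℚ.* q′
  *-mono-≤ {p} {p′} {q} {q′} 0≤p p≤p′ 0≤q q≤q′ = ℚ.≤-trans
    (ℚ.*-monoʳ-≤-nonNeg q {{ℚ.nonNegative 0≤q}} p≤p′)
    (ℚ.*-monoˡ-≤-nonNeg p′ {{ℚ.nonNegative (ℚ.≤-trans 0≤p p≤p′)}} q≤q′)

  p≤∣p∣ : ∀ p → p ℚ.≤ ∣ p ∣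
  p≤∣p∣ p with ℚ.≤-total 0ℚ p
  ... | inj₁ 0≤p = ℚ.≤-reflexive (sym (ℚ.0≤p⇒∣p∣≡p 0≤p))
  ... | inj₂ p≤0 = ℚ.≤-trans p≤0 (ℚ.0≤∣p∣ p)

  ∣p-q∣≡∣q-p∣ : ∀ p q → ∣ p ℚ.- q ∣ ≡ ∣ q ℚ.- p ∣
  ∣p-q∣≡∣q-p∣ p q = trans
    (cong ∣_∣ (solve 2 (λ p q → p :- q := :- (q :- p)) refl p q)) (ℚ.∣-p∣≡∣p∣ (q ℚ.- p))

  <+⇒-< : ∀ p q → p ℚ.< q ℚ.+ ε → p ℚ.- q ℚ.< ε
  <+⇒-< {ε} p q h = subst (p ℚ.- q ℚ.<_) (solve 2 (λ q ε → (q :+ ε) :- q := ε) refl q ε)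
    (ℚ.+-monoˡ-< (ℚ.- q) h)

  -<⇒<+ : ∀ p q → p ℚ.- q ℚ.< ε → p ℚ.< q ℚ.+ ε
  -<⇒<+ {ε} p q h = subst₂ ℚ._<_ (solve 2 (λ p q → (p :- q) :+ q := p) refl p q) (ℚ.+-comm ε q)
    (ℚ.+-monoˡ-< q h)

  close⇒<+ : ∀ p q → ∣ p ℚ.- q ∣ ℚ.< ε → p ℚ.< q ℚ.+ ε
  close⇒<+ p q h = -<⇒<+ p q (ℚ.≤-<-trans (p≤∣p∣ _) h)

  <+⇒close : ∀ p q → p ℚ.< q ℚ.+ ε → q ℚ.< p ℚ.+ ε → ∣ p ℚ.- q ∣ ℚ.< ε
  <+⇒close {ε} p q h k with ℚ.∣p∣≡p∨∣p∣≡-p (p ℚ.- q)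
  ... | inj₁ e = subst (ℚ._< ε) (sym e) (<+⇒-< p q h)
  ... | inj₂ e = subst (ℚ._< ε)
    (sym (trans e (solve 2 (λ p q → :- (p :- q) := q :- p) refl p q))) (<+⇒-< q p k)

  toℚᵘ-/ : ∀ i n → ℚ.toℚᵘ (i ℚ./ suc n) ℚᵘ.≃ (i ℚᵘ./ suc n)
  toℚᵘ-/ i n = ℚ.toℚᵘ-fromℚᵘ (ℚᵘ.mkℚᵘ i n)

  /-mono-≤ : ∀ a b c d → a ℕ.* suc d ℕ.≤ c ℕ.* suc b → + a ℚ./ suc b ℚ.≤ + c ℚ./ suc d
  /-mono-≤ a b c d h = ℚ.toℚᵘ-cancel-≤
    (ℚᵘ.≤-respˡ-≃ (ℚᵘ.≃-sym (toℚᵘ-/ (+ a) b)) (ℚᵘ.≤-respʳ-≃ (ℚᵘ.≃-sym (toℚᵘ-/ (+ c) d))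
      (ℚᵘ.*≤* (subst₂ ℤ._≤_ (ℤ.pos-* a (suc d)) (ℤ.pos-* c (suc b)) (ℤ.+≤+ h)))))

  suc-/ : ∀ j n → + suc j ℚ./ suc n ≡ + j ℚ./ suc n ℚ.+ + 1 ℚ./ suc n
  suc-/ j n = ℚ.toℚᵘ-injective (ℚᵘ.≃-trans (toℚᵘ-/ (+ suc j) n) (ℚᵘ.≃-trans
      (ℚᵘ.*≡* (trans (sym (ℤ.pos-* (suc j) (suc n ℕ.* suc n))) (trans (cong +_ eq)
        (trans (ℤ.pos-* (j ℕ.* suc n ℕ.+ 1 ℕ.* suc n) (suc n)) (cong (ℤ._* + suc n) (trans (ℤ.pos-+ (j ℕ.* suc n) (1 ℕ.* suc n)) (cong₂ ℤ._+_ (ℤ.pos-* j (suc n)) (ℤ.pos-* 1 (suc n)))))))))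
      (ℚᵘ.≃-trans (ℚᵘ.+-cong (ℚᵘ.≃-sym (toℚᵘ-/ (+ j) n)) (ℚᵘ.≃-sym (toℚᵘ-/ (+ 1) n)))
        (ℚᵘ.≃-sym (ℚ.toℚᵘ-homo-+ (+ j ℚ./ suc n) (+ 1 ℚ./ suc n))))))
    where
      eq : suc j ℕ.* (suc n ℕ.* suc n) ≡ (j ℕ.* suc n ℕ.+ 1 ℕ.* suc n) ℕ.* suc n
      eq = trans (sym (ℕ.*-assoc (suc j) (suc n) (suc n))) (cong (ℕ._* suc n)
        (trans (ℕ.+-comm (suc n) (j ℕ.* suc n)) (cong (j ℕ.* suc n ℕ.+_) (sym (ℕ.*-identityˡ (suc n))))))

  0≤/ : ∀ j n → 0ℚ ℚ.≤ + j ℚ./ suc n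
  0≤/ j n = /-mono-≤ 0 0 j n ℕ.z≤n

  0</ : ∀ j n → 0ℚ ℚ.< + suc j ℚ./ suc n
  0</ j n = ℚ.positive⁻¹ (+ suc j ℚ./ suc n) {{ℚ.normalize-pos (suc j) (suc n)}}

  archimedean : 0ℚ ℚ.< ε → ∃ λ N → ∀ n → N ℕ.≤ n → + 1 ℚ./ suc n ℚ.≤ ε
  archimedean {ε@(mkℚ (+ zero) d c)} 0<ε = ⊥-elim (ℤ.<-irrefl refl (subst₂ ℤ._<_ refl refl (ℚ.drop-*<* 0<ε)))
  archimedean {ε@(mkℚ (+ suc a) d c)} 0<ε = d , λ n d≤n →
    subst (+ 1 ℚ./ suc n ℚ.≤_) (ℚ.↥p/↧p≡p ε)
      (/-mono-≤ 1 n (suc a) d (ℕ.≤-trans (ℕ.≤-reflexive (ℕ.*-identityˡ (suc d)))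
        (ℕ.≤-trans (ℕ.s≤s d≤n) (ℕ.m≤m+n (suc n) _))))
  archimedean {ε@(mkℚ ℤ.-[1+ a ] d c)} 0<ε = contradiction (ℚ.drop-*<* 0<ε) λ ()

  num-bound : ∀ q → q ℚ.≤ + ℤ.∣ ↥ q ∣ ℚ./ 1
  num-bound q@(mkℚ n d c) = ℚ.≤-trans (p≤∣p∣ q) (subst (ℚ._≤ + ℤ.∣ n ∣ ℚ./ 1) (ℚ.↥p/↧p≡p ∣ q ∣)
    (/-mono-≤ ℤ.∣ n ∣ d ℤ.∣ n ∣ 0
      (ℕ.*-monoʳ-≤ ℤ.∣ n ∣ {1} {suc d} (ℕ.s≤s ℕ.z≤n))))

-- The reals, as Cauchy sequences of rationals up to _≈_

Cauchy : (ℕ → ℚ) → Set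
Cauchy x = ∀ ε → 0ℚ ℚ.< ε →
  ∃ λ N → ∀ m n → N ℕ.≤ m → N ℕ.≤ n → ∣ x m ℚ.- x n ∣ ℚ.< ε

record ℝ : Set where
  constructor mkℝ
  field
    seq    : ℕ → ℚ
    cauchy : Cauchy seq

open ℝ public

infix 4 _≈_ _<_ _≤_

record _≈_ (x y : ℝ) : Set where
  constructor mk≈
  field
    close : ∀ ε → 0ℚ ℚ.< ε → ∃ λ N → ∀ n → N ℕ.≤ n → ∣ seq x n ℚ.- seq y n ∣ ℚ.< ε

record _<_ (x y : ℝ) : Set where
  constructor mk<
  field
    gap     : ℚ
    gap-pos : 0ℚ ℚ.< gap
    apart   : ∃ λ N → ∀ n → N ℕ.≤ n → seq x n ℚ.+ gap ℚ.≤ seq y n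

record _≤_ (x y : ℝ) : Set where
  constructor mk≤
  field
    within : ∀ ε → 0ℚ ℚ.< ε → ∃ λ N → ∀ n → N ℕ.≤ n → seq x n ℚ.≤ seq y n ℚ.+ ε

abstract

  mkCauchy : ∀ {x} → (∀ ε → 0ℚ ℚ.< ε →
             ∃ λ N → ∀ m n → N ℕ.≤ m → N ℕ.≤ n → x m ℚ.< x n ℚ.+ ε) → Cauchy x
  mkCauchy {x} h ε 0<ε with h ε 0<ε
  ... | N , k = N , λ m n N≤m N≤n → <+⇒close (x m) (x n) (k m n N≤m N≤n) (k n m N≤n N≤m)

  const-cauchy : ∀ q → Cauchy (λ _ → q)
  const-cauchy q = mkCauchy λ ε 0<ε → 0 , λ _ _ _ _ →
    subst (ℚ._< q ℚ.+ ε) (ℚ.+-identityʳ q) (ℚ.+-monoʳ-< q 0<ε)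

  +-cauchy : ∀ x y → Cauchy x → Cauchy y → Cauchy (λ n → x n ℚ.+ y n)
  +-cauchy x y cx cy = mkCauchy λ ε 0<ε →
    let (N₁ , h₁) = cx (ε ℚ.* ½) (½-pos 0<ε)
        (N₂ , h₂) = cy (ε ℚ.* ½) (½-pos 0<ε)
    in N₁ ℕ.⊔ N₂ , λ m n N≤m N≤n →
      subst (x m ℚ.+ y m ℚ.<_)
        (trans (solve 3 (λ a b e → (a :+ e) :+ (b :+ e) := (a :+ b) :+ (e :+ e)) refl (x n) (y n) (ε ℚ.* ½))
               (cong (x n ℚ.+ y n ℚ.+_) (½+½ ε)))
        (ℚ.+-mono-<
          (close⇒<+ (x m) (x n) (h₁ m n (ℕ.m⊔n≤o⇒m≤o N₁ N₂ N≤m) (ℕ.m⊔n≤o⇒m≤o N₁ N₂ N≤n)))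
          (close⇒<+ (y m) (y n) (h₂ m n (ℕ.m⊔n≤o⇒n≤o N₁ N₂ N≤m) (ℕ.m⊔n≤o⇒n≤o N₁ N₂ N≤n))))

  neg-cauchy : ∀ x → Cauchy x → Cauchy (λ n → ℚ.- x n)
  neg-cauchy x cx ε 0<ε with cx ε 0<ε
  ... | N , h = N , λ m n N≤m N≤n → subst (ℚ._< ε)
    (trans (∣p-q∣≡∣q-p∣ (x m) (x n))
      (cong ∣_∣ (solve 2 (λ a b → b :- a := (:- a) :- (:- b)) refl (x m) (x n))))
    (h m n N≤m N≤n)

  bounded : ∀ {x} → Cauchy x → ∃ λ B → 0ℚ ℚ.< B × ∃ λ N → ∀ n → N ℕ.≤ n → ∣ x n ∣ ℚ.≤ B
  bounded {x} cx with cx 1ℚ (0</ 0 0)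
  ... | N , h = ∣ x N ∣ ℚ.+ 1ℚ , 0<B , N , λ n N≤n →
      ℚ.≤-trans (ℚ.≤-reflexive (cong ∣_∣ (solve 2 (λ a b → a := b :+ (a :- b)) refl (x n) (x N))))
        (ℚ.≤-trans (ℚ.∣p+q∣≤∣p∣+∣q∣ (x N) (x n ℚ.- x N))
          (ℚ.+-monoʳ-≤ ∣ x N ∣ (ℚ.<⇒≤ (h n N N≤n ℕ.≤-refl))))
    where
      0<B : 0ℚ ℚ.< ∣ x N ∣ ℚ.+ 1ℚ
      0<B = ℚ.+-mono-≤-< (ℚ.0≤∣p∣ (x N)) (0</ 0 0)

inv : ℚ → ℚ
inv q with q ℚ.≟ 0ℚ
... | yes _   = 0ℚ
... | no q≢0 = ℚ.1/_ q {{ℚ.≢-nonZero q≢0}}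

abstract

  inv-inverse : 0ℚ ℚ.< q → q ℚ.* inv q ≡ 1ℚ
  inv-inverse {q} 0<q with q ℚ.≟ 0ℚ
  ... | yes q≡0 = contradiction (sym q≡0) (ℚ.<⇒≢ 0<q)
  ... | no q≢0 = ℚ.*-inverseʳ q {{ℚ.≢-nonZero q≢0}}

  inv-pos : 0ℚ ℚ.< q → 0ℚ ℚ.< inv q
  inv-pos {q} 0<q = ℚ.*-cancelˡ-<-nonNeg q {{ℚ.nonNegative (ℚ.<⇒≤ 0<q)}}
    (subst₂ ℚ._<_ (sym (ℚ.*-zeroʳ q)) (sym (inv-inverse 0<q)) (0</ 0 0))

  *-cauchy : ∀ x y → Cauchy x → Cauchy y → Cauchy (λ n → x n ℚ.* y n)
  *-cauchy x y cx cy ε 0<ε =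
    let (B , 0<B , K₁ , b₁) = bounded cx
        (C , 0<C , K₂ , b₂) = bounded cy
        (N₁ , h₁) = cy (ε ℚ.* ½ ℚ.* inv B) (*-pos (½-pos 0<ε) (inv-pos 0<B))
        (N₂ , h₂) = cx (ε ℚ.* ½ ℚ.* inv C) (*-pos (½-pos 0<ε) (inv-pos 0<C))
    in (K₁ ℕ.⊔ K₂) ℕ.⊔ (N₁ ℕ.⊔ N₂) , λ m n N≤m N≤n →
      let m≥K = ℕ.m⊔n≤o⇒m≤o (K₁ ℕ.⊔ K₂) (N₁ ℕ.⊔ N₂) N≤m
          n≥K = ℕ.m⊔n≤o⇒m≤o (K₁ ℕ.⊔ K₂) (N₁ ℕ.⊔ N₂) N≤n
          m≥N = ℕ.m⊔n≤o⇒n≤o (K₁ ℕ.⊔ K₂) (N₁ ℕ.⊔ N₂) N≤m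
          n≥N = ℕ.m⊔n≤o⇒n≤o (K₁ ℕ.⊔ K₂) (N₁ ℕ.⊔ N₂) N≤n
          t₁ = part B 0<B (x m) (y m ℚ.- y n) (b₁ m (ℕ.m⊔n≤o⇒m≤o K₁ K₂ m≥K))
                 (h₁ m n (ℕ.m⊔n≤o⇒m≤o N₁ N₂ m≥N) (ℕ.m⊔n≤o⇒m≤o N₁ N₂ n≥N))
          t₂ = part C 0<C (y n) (x m ℚ.- x n) (b₂ n (ℕ.m⊔n≤o⇒n≤o K₁ K₂ n≥K))
                 (h₂ m n (ℕ.m⊔n≤o⇒n≤o N₁ N₂ m≥N) (ℕ.m⊔n≤o⇒n≤o N₁ N₂ n≥N))
      in subst₂ ℚ._<_
           (cong ∣_∣ (solve 4 (λ a b c d → a :* (c :- d) :+ d :* (a :- b) := a :* c :- b :* d) refl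
              (x m) (x n) (y m) (y n)))
           (½+½ ε)
           (ℚ.≤-<-trans (ℚ.∣p+q∣≤∣p∣+∣q∣ (x m ℚ.* (y m ℚ.- y n)) (y n ℚ.* (x m ℚ.- x n)))
             (ℚ.+-mono-< t₁ t₂))
    where
      part : ∀ B → 0ℚ ℚ.< B → ∀ a d → ∣ a ∣ ℚ.≤ B → ∣ d ∣ ℚ.< ε ℚ.* ½ ℚ.* inv B →
             ∣ a ℚ.* d ∣ ℚ.< ε ℚ.* ½
      part B 0<B a d a≤B d< = ℚ.≤-<-trans
        (ℚ.≤-trans (ℚ.≤-reflexive (ℚ.∣p*q∣≡∣p∣*∣q∣ a d))
          (ℚ.*-monoʳ-≤-nonNeg ∣ d ∣ {{ℚ.∣-∣-nonNeg d}} a≤B))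
        (subst (B ℚ.* ∣ d ∣ ℚ.<_)
          (trans (solve 3 (λ b e i → b :* (e :* i) := e :* (b :* i)) refl B (ε ℚ.* ½) (inv B))
            (trans (cong (ε ℚ.* ½ ℚ.*_) (inv-inverse 0<B)) (ℚ.*-identityʳ (ε ℚ.* ½))))
          (ℚ.*-monoʳ-<-pos B {{ℚ.positive 0<B}} d<))

  inv-cauchy : ∀ x → Cauchy x → 0ℚ ℚ.< δ → (∃ λ N → ∀ n → N ℕ.≤ n → δ ℚ.≤ x n) →
               Cauchy (λ n → inv (x n))
  inv-cauchy {δ} x cx 0<δ (K , k) = mkCauchy λ ε 0<ε →
    let (N , h) = cx (δ ℚ.* δ ℚ.* ε) (*-pos (*-pos 0<δ 0<δ) 0<ε)
    in K ℕ.⊔ N , λ m n N≤m N≤n →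
      go (x m) (x n) ε 0<ε (k m (ℕ.m⊔n≤o⇒m≤o K N N≤m)) (k n (ℕ.m⊔n≤o⇒m≤o K N N≤n))
        (close⇒<+ (x n) (x m) (h n m (ℕ.m⊔n≤o⇒n≤o K N N≤n) (ℕ.m⊔n≤o⇒n≤o K N N≤m)))
    where
      go : ∀ a b ε → 0ℚ ℚ.< ε → δ ℚ.≤ a → δ ℚ.≤ b → b ℚ.< a ℚ.+ δ ℚ.* δ ℚ.* ε →
           inv a ℚ.< inv b ℚ.+ ε
      go a b ε 0<ε δ≤a δ≤b h = ℚ.*-cancelˡ-<-nonNeg (a ℚ.* b) {{ℚ.nonNegative (ℚ.<⇒≤ (*-pos 0<a 0<b))}}
        (subst₂ ℚ._<_
          (sym (trans (solve 3 (λ a b u → (a :* b) :* u := (a :* u) :* b) refl a b (inv a))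
            (trans (cong (ℚ._* b) (inv-inverse 0<a)) (ℚ.*-identityˡ b))))
          (sym (trans (solve 4 (λ a b v e → (a :* b) :* (v :+ e) := (b :* v) :* a :+ a :* b :* e) refl a b (inv b) ε)
            (cong (ℚ._+ a ℚ.* b ℚ.* ε) (trans (cong (ℚ._* a) (inv-inverse 0<b)) (ℚ.*-identityˡ a)))))
          (ℚ.<-≤-trans h (ℚ.+-monoʳ-≤ a (ℚ.*-monoʳ-≤-nonNeg ε {{ℚ.nonNegative (ℚ.<⇒≤ 0<ε)}}
            (*-mono-≤ (ℚ.<⇒≤ 0<δ) δ≤a (ℚ.<⇒≤ 0<δ) δ≤b)))))
        where
          0<a : 0ℚ ℚ.< a
          0<a = ℚ.<-≤-trans 0<δ δ≤a
          0<b : 0ℚ ℚ.< b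
          0<b = ℚ.<-≤-trans 0<δ δ≤b

-- The largest g j with j ≤ J and (g j)² ≤ q, or 0 if there is none.
largestRoot : (ℕ → ℚ) → ℚ → ℕ → ℚ
largestRoot g q zero = 0ℚ
largestRoot g q (suc j) with g (suc j) ℚ.* g (suc j) ℚ.≤? q
... | yes _ = g (suc j)
... | no  _ = largestRoot g q j

-- √q rounded down to a multiple of 1/(n+1), or 0 if q < 0.  The search may stop at
-- |numerator of q| + 1, which exceeds √q.
sqrtApprox : ℕ → ℚ → ℚ
sqrtApprox n q = largestRoot (λ j → + j ℚ./ suc n) q (suc ℤ.∣ ↥ q ∣ ℕ.* suc n)

abstract

  largestRoot-lower : ∀ g q J → largestRoot g q J ≡ 0ℚ ⊎ largestRoot g q J ℚ.* largestRoot g q J ℚ.≤ q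
  largestRoot-lower g q zero = inj₁ refl
  largestRoot-lower g q (suc j) with g (suc j) ℚ.* g (suc j) ℚ.≤? q
  ... | yes h = inj₂ h
  ... | no  _ = largestRoot-lower g q j

  largestRoot-nonNeg : ∀ g q J → (∀ j → 0ℚ ℚ.≤ g j) → 0ℚ ℚ.≤ largestRoot g q J
  largestRoot-nonNeg g q zero 0≤g = ℚ.≤-refl
  largestRoot-nonNeg g q (suc j) 0≤g with g (suc j) ℚ.* g (suc j) ℚ.≤? q
  ... | yes h = 0≤g (suc j)
  ... | no  _ = largestRoot-nonNeg g q j 0≤g

  largestRoot-upper : ∀ g δ q J → g 1 ≡ δ → (∀ j → g (suc j) ≡ g j ℚ.+ δ) →
    q ℚ.< g (suc J) ℚ.* g (suc J) →
    q ℚ.< (largestRoot g q J ℚ.+ δ) ℚ.* (largestRoot g q J ℚ.+ δ)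
  largestRoot-upper g δ q zero g1 g+ h =
    subst (λ t → q ℚ.< t ℚ.* t) (trans g1 (sym (ℚ.+-identityˡ δ))) h
  largestRoot-upper g δ q (suc j) g1 g+ h with g (suc j) ℚ.* g (suc j) ℚ.≤? q
  ... | yes _ = subst (λ t → q ℚ.< t ℚ.* t) (g+ (suc j)) h
  ... | no ¬h = largestRoot-upper g δ q j g1 g+ (ℚ.≰⇒> ¬h)

  num<square : ∀ q n → let t = + suc (suc ℤ.∣ ↥ q ∣ ℕ.* suc n) ℚ./ suc n in q ℚ.< t ℚ.* t
  num<square q n = go t refl
    where
      a b : ℕ
      a = ℤ.∣ ↥ q ∣
      b = suc a ℕ.* suc n
      t : ℚ
      t = + suc b ℚ./ suc n
      c≤t : + suc a ℚ./ 1 ℚ.≤ t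
      c≤t = /-mono-≤ (suc a) 0 (suc b) n
        (ℕ.≤-trans (ℕ.n≤1+n b) (ℕ.≤-reflexive (sym (ℕ.*-identityʳ (suc b)))))
      q<c : q ℚ.< + suc a ℚ./ 1
      q<c = ℚ.≤-<-trans (num-bound q) (subst₂ ℚ._<_ (ℚ.+-identityʳ (+ a ℚ./ 1)) (sym (suc-/ a 0))
        (ℚ.+-monoʳ-< (+ a ℚ./ 1) (0</ 0 0)))
      1≤c : 1ℚ ℚ.≤ + suc a ℚ./ 1
      1≤c = /-mono-≤ 1 0 (suc a) 0 (ℕ.s≤s ℕ.z≤n)
      go : ∀ u → u ≡ t → q ℚ.< u ℚ.* u
      go u e = ℚ.<-≤-trans (ℚ.<-≤-trans q<c c≤u) (subst (ℚ._≤ u ℚ.* u) (ℚ.*-identityˡ u)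
        (ℚ.*-monoʳ-≤-nonNeg u {{ℚ.nonNegative (ℚ.≤-trans (0≤/ 1 0) 1≤u)}} 1≤u))
        where
          c≤u : + suc a ℚ./ 1 ℚ.≤ u
          c≤u = subst (+ suc a ℚ./ 1 ℚ.≤_) (sym e) c≤t
          1≤u : 1ℚ ℚ.≤ u
          1≤u = ℚ.≤-trans 1≤c c≤u

  -- s and t play √a and √b rounded down, δ the grid width.
  root-gap : ∀ {a b s t h δ} → 0ℚ ℚ.< h → 0ℚ ℚ.≤ δ → δ ℚ.≤ h → 0ℚ ℚ.≤ t →
             (s ≡ 0ℚ ⊎ s ℚ.* s ℚ.≤ a) → b ℚ.< (t ℚ.+ δ) ℚ.* (t ℚ.+ δ) →
             t ℚ.+ (h ℚ.+ h) ℚ.≤ s → b ℚ.+ h ℚ.* h ℚ.≤ a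
  root-gap {t = t} {h} 0<h 0≤δ δ≤h 0≤t (inj₁ s≡0) _ far = contradiction
    (ℚ.<-≤-trans (ℚ.+-mono-≤-< 0≤t (ℚ.+-mono-< 0<h 0<h)) (ℚ.≤-trans far (ℚ.≤-reflexive s≡0)))
    (ℚ.<-irrefl refl)
  root-gap {a} {b} {s} {t} {h} {δ} 0<h 0≤δ δ≤h 0≤t (inj₂ s²≤a) b< far =
    ℚ.≤-trans
      (ℚ.+-monoˡ-≤ (h ℚ.* h) (ℚ.≤-trans (ℚ.<⇒≤ b<) (*-mono-≤ 0≤t+δ t+δ≤ 0≤t+δ t+δ≤)))
      (ℚ.≤-trans
        (subst₂ ℚ._≤_ (ℚ.+-identityʳ ((t ℚ.+ h) ℚ.* (t ℚ.+ h) ℚ.+ h ℚ.* h))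
          (solve 2 (λ t h → (t :+ h) :* (t :+ h) :+ h :* h :+ h :* (t :+ t :+ (h :+ h))
                            := (t :+ (h :+ h)) :* (t :+ (h :+ h))) refl t h)
          (ℚ.+-monoʳ-≤ ((t ℚ.+ h) ℚ.* (t ℚ.+ h) ℚ.+ h ℚ.* h)
            (*-mono-≤ {0ℚ} {h} {0ℚ} ℚ.≤-refl 0≤h ℚ.≤-refl (ℚ.+-mono-≤ (ℚ.+-mono-≤ 0≤t 0≤t) (ℚ.+-mono-≤ 0≤h 0≤h)))))
        (ℚ.≤-trans (*-mono-≤ 0≤t+2h far 0≤t+2h far) s²≤a))
    where
      0≤h : 0ℚ ℚ.≤ h
      0≤h = ℚ.<⇒≤ 0<h
      0≤t+δ : 0ℚ ℚ.≤ t ℚ.+ δ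
      0≤t+δ = ℚ.+-mono-≤ 0≤t 0≤δ
      t+δ≤ : t ℚ.+ δ ℚ.≤ t ℚ.+ h
      t+δ≤ = ℚ.+-monoʳ-≤ t δ≤h
      0≤t+2h : 0ℚ ℚ.≤ t ℚ.+ (h ℚ.+ h)
      0≤t+2h = ℚ.+-mono-≤ 0≤t (ℚ.+-mono-≤ 0≤h 0≤h)

  sqrtApprox-lower : ∀ n q → sqrtApprox n q ≡ 0ℚ ⊎ sqrtApprox n q ℚ.* sqrtApprox n q ℚ.≤ q
  sqrtApprox-lower n q = largestRoot-lower (λ j → + j ℚ./ suc n) q (suc ℤ.∣ ↥ q ∣ ℕ.* suc n)

  sqrtApprox-nonNeg : ∀ n q → 0ℚ ℚ.≤ sqrtApprox n q
  sqrtApprox-nonNeg n q =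
    largestRoot-nonNeg (λ j → + j ℚ./ suc n) q (suc ℤ.∣ ↥ q ∣ ℕ.* suc n) (λ j → 0≤/ j n)

  sqrtApprox-upper : ∀ n q → q ℚ.< (sqrtApprox n q ℚ.+ + 1 ℚ./ suc n) ℚ.* (sqrtApprox n q ℚ.+ + 1 ℚ./ suc n)
  sqrtApprox-upper n q = largestRoot-upper (λ j → + j ℚ./ suc n) (+ 1 ℚ./ suc n) q
    (suc ℤ.∣ ↥ q ∣ ℕ.* suc n) refl (λ j → suc-/ j n) (num<square q n)

  sqrt-cauchy : ∀ x → Cauchy x → Cauchy (λ n → sqrtApprox n (x n))
  sqrt-cauchy x cx = mkCauchy λ ε 0<ε →
    let (N₁ , h₁) = archimedean (½-pos 0<ε)
        (N₂ , h₂) = cx (ε ℚ.* ½ ℚ.* (ε ℚ.* ½)) (*-pos (½-pos 0<ε) (½-pos 0<ε))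
    in N₁ ℕ.⊔ N₂ , λ m n N≤m N≤n → ℚ.≰⇒> λ far →
      ℚ.<-irrefl refl (ℚ.<-≤-trans
        (close⇒<+ (x m) (x n) (h₂ m n (ℕ.m⊔n≤o⇒n≤o N₁ N₂ N≤m) (ℕ.m⊔n≤o⇒n≤o N₁ N₂ N≤n)))
        (root-gap (½-pos 0<ε) (0≤/ 1 n) (h₁ n (ℕ.m⊔n≤o⇒m≤o N₁ N₂ N≤n))
          (sqrtApprox-nonNeg n (x n)) (sqrtApprox-lower m (x m)) (sqrtApprox-upper n (x n))
          (subst (λ e → sqrtApprox n (x n) ℚ.+ e ℚ.≤ sqrtApprox m (x m)) (sym (½+½ ε)) far)))

fromℚ : ℚ → ℝ
fromℚ q = mkℝ (λ _ → q) (const-cauchy q)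

fromℕ : ℕ → ℝ
fromℕ n = fromℚ (+ n ℚ./ 1)

0ℝ 1ℝ : ℝ
0ℝ = fromℕ 0
1ℝ = fromℕ 1

infix  8 -_
infix  9 _²
infixl 7 _*_ _÷_[_]
infixl 6 _+_ _-_

_+_ : ℝ → ℝ → ℝ
x + y = mkℝ (λ n → seq x n ℚ.+ seq y n) (+-cauchy (seq x) (seq y) (cauchy x) (cauchy y))

-_ : ℝ → ℝ
- x = mkℝ (λ n → ℚ.- seq x n) (neg-cauchy (seq x) (cauchy x))

_-_ : ℝ → ℝ → ℝ
x - y = x + - y

_*_ : ℝ → ℝ → ℝ
x * y = mkℝ (λ n → seq x n ℚ.* seq y n) (*-cauchy (seq x) (seq y) (cauchy x) (cauchy y))

_² : ℝ → ℝ
x ² = x * x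

abstract

  away-from-0 : ∀ {y} (0<y : 0ℝ < y) → ∃ λ N → ∀ n → N ℕ.≤ n → _<_.gap 0<y ℚ.≤ seq y n
  away-from-0 {y} (mk< δ _ (N , h)) = N , λ n N≤n →
    subst (ℚ._≤ seq y n) (ℚ.+-identityˡ δ) (h n N≤n)

-- The positivity proof is used only to show that the sequence of quotients is Cauchy.
_÷_[_] : (x y : ℝ) → 0ℝ < y → ℝ
x ÷ y [ 0<y ] = mkℝ (λ n → seq x n ℚ.* inv (seq y n))
  (*-cauchy (seq x) (λ n → inv (seq y n)) (cauchy x)
    (inv-cauchy (seq y) (cauchy y) (_<_.gap-pos 0<y) (away-from-0 0<y)))

√_ : ℝ → ℝ
√ x = mkℝ (λ n → sqrtApprox n (seq x n)) (sqrt-cauchy (seq x) (cauchy x))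

abstract

  <-≤-trans : ∀ {x y z} → x < y → y ≤ z → x < z
  <-≤-trans {x} {y} {z} (mk< ε 0<ε (N₁ , h₁)) (mk≤ y≤z) =
    let (N₂ , h₂) = y≤z (ε ℚ.* ½) (½-pos 0<ε)
    in mk< (ε ℚ.* ½) (½-pos 0<ε) (N₁ ℕ.⊔ N₂ , λ n N≤n →
      subst₂ ℚ._≤_
        (solve 2 (λ x e → (x :+ (e :+ e)) :- e := x :+ e) refl (seq x n) (ε ℚ.* ½))
        (solve 2 (λ z e → (z :+ e) :- e := z) refl (seq z n) (ε ℚ.* ½))
        (ℚ.+-monoˡ-≤ (ℚ.- (ε ℚ.* ½))
          (ℚ.≤-trans (subst (λ e → seq x n ℚ.+ e ℚ.≤ seq y n) (sym (½+½ ε))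
                       (h₁ n (ℕ.m⊔n≤o⇒m≤o N₁ N₂ N≤n)))
            (h₂ n (ℕ.m⊔n≤o⇒n≤o N₁ N₂ N≤n)))))

-- z = sup { f i | i : I }, in the constructive sense: z is an upper bound approximated
-- from below by values of f.  Such a z is the least upper bound (sup-least).
record IsSup {I : Set} (f : I → ℝ) (z : ℝ) : Set where
  field
    upper        : ∀ i → f i ≤ z
    approximated : ∀ w → w < z → ∃ λ i → w < f i

abstract

  sup-least : ∀ {I} {f : I → ℝ} {z} → IsSup f z → ∀ b → (∀ i → f i ≤ b) → z ≤ b
  sup-least {f = f} {z} isSup b f≤b = mk≤ λ ε 0<ε →
    let (i , w<fi) = IsSup.approximated isSup (z - fromℚ ε)
                       (mk< ε 0<ε (0 , λ n _ → ℚ.≤-reflexive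
                         (solve 2 (λ z e → (z :- e) :+ e := z) refl (seq z n) ε)))
        mk< δ 0<δ (N , h) = <-≤-trans w<fi (f≤b i)
    in N , λ n N≤n →
      subst (ℚ._≤ seq b n ℚ.+ ε) (solve 2 (λ z e → (z :- e) :+ e := z) refl (seq z n) ε)
        (ℚ.+-monoˡ-≤ ε (ℚ.≤-trans
          (subst (ℚ._≤ seq z n ℚ.- ε ℚ.+ δ) (ℚ.+-identityʳ (seq z n ℚ.- ε))
            (ℚ.+-monoʳ-≤ (seq z n ℚ.- ε) (ℚ.<⇒≤ 0<δ)))
          (h n N≤n)))

mean : ∀ {k} .{{_ : NonTrivial k}} → (Fin k → ℝ) → ℝ
mean {k} v = fromℚ ((+ 1 ℚ./ k) {{nonTrivial⇒nonZero k}}) * foldr _+_ 0ℝ v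

record PriceIntervals (k : ℕ) : Set where
  field
    m M : Fin k → ℝ
    0<m : ∀ i → 0ℝ < m i
    m≤M : ∀ i → m i ≤ M i

  fluctuationRatio : Fin k → ℝ
  fluctuationRatio i = M i ÷ m i [ 0<m i ]

  record 𝒮 .{{_ : NonTrivial k}} : Set where
    field
      x   : Fin k → ℝ
      m≤x : ∀ i → m i ≤ x i
      x≤M : ∀ i → x i ≤ M i

    0<x : ∀ i → 0ℝ < x i
    0<x i = <-≤-trans (0<m i) (m≤x i)

    field
      balanced : mean (λ i → x i ÷ m i [ 0<m i ]) ≈ mean (λ i → M i ÷ x i [ 0<x i ])

  meanRatio : .{{_ : NonTrivial k}} → 𝒮 → ℝ
  meanRatio s = mean λ i → M i ÷ x i [ 0<x i ]
    where open 𝒮 s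

  -- z is the arithmetic mean component competitive ratio.
  IsCompetitiveRatio : .{{_ : NonTrivial k}} → ℝ → Set
  IsCompetitiveRatio z = IsSup meanRatio z

{-# OPTIONS --safe #-}

-- Put yᵢ = xᵢ/mᵢ = 1 + pᵢ, Mᵢ/xᵢ = 1 + qᵢ and aᵢ = rᵢ − 1 = pᵢ + qᵢ + pᵢqᵢ.  As the two means
-- agree and (1 + pᵢ) + (1 + qᵢ) = rᵢ + 1 − pᵢqᵢ, maximising the mean is minimising Σ pᵢqᵢ subject
-- to Σ (pᵢ − qᵢ) = 0.  The claimed optimum takes objectives 1, 2, 4 at interval ends and the third
-- at (h*, k*), where h* + k* + h*k* = a₃ and k* − h* = a₁ − a₂ + a₄.
--
-- Let h ≤ k be pᵢ and qᵢ in increasing order, for i ≤ 3, and δ = a₂ + a₃ − a₁ − a₄ = h*k* + 2h* > 0.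
-- If h* ≤ h then already pᵢqᵢ ≥ h*k*.  Otherwise pᵢqᵢ lies above a chord:
-- δ pᵢqᵢ ≥ h*k* tᵢ with tᵢ = hk + 2h = aᵢ − |pᵢ − qᵢ|.  If this happens for i = 1, 2, 3, then adding up
-- and using |p₁ − q₁| + |p₂ − q₂| + |p₃ − q₃| ≤ 2a₁ + a₄, that is t₁ + t₂ + t₃ ≥ δ, gives the bound.
-- The case distinctions are legitimate because ≤ on the Cauchy reals is ¬¬-stable.

module Submission where

open import Algebra.Bundles using (CommutativeRing)
import Algebra.Solver.Ring as RingSolver
open import Algebra.Solver.Ring.AlmostCommutativeRing
  using (AlmostCommutativeRing; Induced-equivalence; _-Raw-AlmostCommutative⟶_; fromCommutativeRing)
open import Data.Fin.Base using (Fin)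
open import Data.Fin.Patterns using (0F; 1F; 2F; 3F)
open import Data.Integer.Base using (+_)
import Data.Maybe.Base as Maybe
import Data.Nat.Base as ℕ
import Data.Nat.Properties as ℕ
open import Data.Product.Base using (∃; _,_)
import Data.Rational.Base as ℚ
import Data.Rational.Properties as ℚ
open import Data.Rational.Solver using () renaming (module +-*-Solver to ℚ-Solver)
open import Data.Sum.Base using (_⊎_; inj₁; inj₂)
open import Function.Base using (_∘_)
open import Level using (0ℓ)
open import Relation.Binary.Definitions using (WeaklyDecidable)
open import Relation.Binary.PropositionalEquality
  using (_≡_; refl; sym; trans; cong; subst; subst₂)
open import Relation.Nullary using (¬_; Dec; yes; no; contradiction)
open import Relation.Nullary.Decidable.Core using (dec⇒maybe)
open import Defs

-- Order and arithmetic of the Cauchy reals.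

private
  variable
    x y z w a b : ℝ

Eventually : (ℕ.ℕ → Set) → Set
Eventually A = ∃ λ N → ∀ n → N ℕ.≤ n → A n

both : ∀ {A B C : ℕ.ℕ → Set} → (∀ n → A n → B n → C n) →
       Eventually A → Eventually B → Eventually C
both f (N₁ , h₁) (N₂ , h₂) = N₁ ℕ.⊔ N₂ , λ n N≤n →
  f n (h₁ n (ℕ.m⊔n≤o⇒m≤o N₁ N₂ N≤n)) (h₂ n (ℕ.m⊔n≤o⇒n≤o N₁ N₂ N≤n))

abstract

  p<p+ε : ∀ p {ε} → ℚ.0ℚ ℚ.< ε → p ℚ.< p ℚ.+ ε
  p<p+ε p {ε} 0<ε = subst (ℚ._< p ℚ.+ ε) (ℚ.+-identityʳ p) (ℚ.+-monoʳ-< p 0<ε)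

  eventually-≤ : Eventually (λ n → seq x n ℚ.≤ seq y n) → x ≤ y
  eventually-≤ {x} {y} (N , h) = mk≤ λ ε 0<ε → N , λ n N≤n →
    ℚ.≤-trans (h n N≤n) (ℚ.<⇒≤ (p<p+ε (seq y n) 0<ε))

  ≤-refl : x ≤ x
  ≤-refl = eventually-≤ (0 , λ _ _ → ℚ.≤-refl)

  ≤-trans : x ≤ y → y ≤ z → x ≤ z
  ≤-trans {x} {y} {z} (mk≤ x≤y) (mk≤ y≤z) = mk≤ λ ε 0<ε →
    both (λ n p q → subst (seq x n ℚ.≤_)
            (trans (ℚ.+-assoc (seq z n) _ _) (cong (seq z n ℚ.+_) (½+½ ε)))
            (ℚ.≤-trans p (ℚ.+-monoˡ-≤ (ε ℚ.* ℚ.½) q)))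
      (x≤y (ε ℚ.* ℚ.½) (½-pos 0<ε)) (y≤z (ε ℚ.* ℚ.½) (½-pos 0<ε))

  <+½⇒<+ : ∀ {p ε} q → ℚ.0ℚ ℚ.< ε → p ℚ.≤ q ℚ.+ ε ℚ.* ℚ.½ → p ℚ.< q ℚ.+ ε
  <+½⇒<+ {p} {ε} q 0<ε h = ℚ.≤-<-trans h
    (subst (q ℚ.+ ε ℚ.* ℚ.½ ℚ.<_) (trans (ℚ.+-assoc q _ _) (cong (q ℚ.+_) (½+½ ε)))
      (p<p+ε (q ℚ.+ ε ℚ.* ℚ.½) (½-pos 0<ε)))

  ≤-antisym : x ≤ y → y ≤ x → x ≈ y
  ≤-antisym {x} {y} (mk≤ x≤y) (mk≤ y≤x) = mk≈ λ ε 0<ε →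
    both (λ n p q → <+⇒close (seq x n) (seq y n) (<+½⇒<+ (seq y n) 0<ε p) (<+½⇒<+ (seq x n) 0<ε q))
      (x≤y (ε ℚ.* ℚ.½) (½-pos 0<ε)) (y≤x (ε ℚ.* ℚ.½) (½-pos 0<ε))

  ≈⇒≤ : x ≈ y → x ≤ y
  ≈⇒≤ {x} {y} (mk≈ h) = mk≤ λ ε 0<ε → let (N , k) = h ε 0<ε in
    N , λ n N≤n → ℚ.<⇒≤ (close⇒<+ (seq x n) (seq y n) (k n N≤n))

  eventually-≡⇒≈ : Eventually (λ n → seq x n ≡ seq y n) → x ≈ y
  eventually-≡⇒≈ (N , h) =
    ≤-antisym (eventually-≤ (N , λ n N≤n → ℚ.≤-reflexive (h n N≤n)))
      (eventually-≤ (N , λ n N≤n → ℚ.≤-reflexive (sym (h n N≤n))))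

  pointwise : (∀ n → seq x n ≡ seq y n) → x ≈ y
  pointwise h = eventually-≡⇒≈ (0 , λ n _ → h n)

  ≈-refl : x ≈ x
  ≈-refl = pointwise λ _ → refl

  ≈-sym : x ≈ y → y ≈ x
  ≈-sym {x} {y} (mk≈ h) = mk≈ λ ε 0<ε → let (N , k) = h ε 0<ε in
    N , λ n N≤n → subst (ℚ._< ε) (∣p-q∣≡∣q-p∣ (seq x n) (seq y n)) (k n N≤n)

  ≥-from-≈ : x ≈ y → y ≤ x
  ≥-from-≈ = ≈⇒≤ ∘ ≈-sym

  ≈-trans : x ≈ y → y ≈ z → x ≈ z
  ≈-trans p q = ≤-antisym (≤-trans (≈⇒≤ p) (≈⇒≤ q)) (≤-trans (≥-from-≈ q) (≥-from-≈ p))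

  +-mono-≤ : x ≤ y → z ≤ w → x + z ≤ y + w
  +-mono-≤ {x} {y} {z} {w} (mk≤ x≤y) (mk≤ z≤w) = mk≤ λ ε 0<ε →
    both (λ n p q → subst (seq x n ℚ.+ seq z n ℚ.≤_)
            (trans (solve 3 (λ y w e → (y :+ e) :+ (w :+ e) := (y :+ w) :+ (e :+ e)) refl
                      (seq y n) (seq w n) (ε ℚ.* ℚ.½))
                   (cong (seq y n ℚ.+ seq w n ℚ.+_) (½+½ ε)))
            (ℚ.+-mono-≤ p q))
      (x≤y (ε ℚ.* ℚ.½) (½-pos 0<ε)) (z≤w (ε ℚ.* ℚ.½) (½-pos 0<ε))
    where open ℚ-Solver

  neg-antimono-≤ : x ≤ y → - y ≤ - x
  neg-antimono-≤ {x} {y} (mk≤ x≤y) = mk≤ λ ε 0<ε → let (N , h) = x≤y ε 0<ε in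
    N , λ n N≤n → subst₂ ℚ._≤_
      (solve 2 (λ a b → a :+ (:- a :+ :- b) := :- b) refl (seq x n) (seq y n))
      (solve 3 (λ a b e → (b :+ e) :+ (:- a :+ :- b) := :- a :+ e) refl (seq x n) (seq y n) ε)
      (ℚ.+-monoˡ-≤ (ℚ.- seq x n ℚ.+ ℚ.- seq y n) (h n N≤n))
    where open ℚ-Solver

  +-cong : x ≈ y → z ≈ w → x + z ≈ y + w
  +-cong p q = ≤-antisym (+-mono-≤ (≈⇒≤ p) (≈⇒≤ q)) (+-mono-≤ (≥-from-≈ p) (≥-from-≈ q))

  neg-cong : x ≈ y → - x ≈ - y
  neg-cong p = ≤-antisym (neg-antimono-≤ (≥-from-≈ p)) (neg-antimono-≤ (≈⇒≤ p))

  -- The terms of `x` are eventually bounded by some `B`, so closeness of `y` and `z` within `ε/B`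
  -- suffices.
  *-congˡ : ∀ x → y ≈ z → x * y ≈ x * z
  *-congˡ {y} {z} x (mk≈ h) = mk≈ λ ε 0<ε →
    let (B , 0<B , bound) = bounded {seq x} (cauchy x)
    in both (λ n b k → subst₂ ℚ._<_
         (sym (trans (cong ℚ.∣_∣ (solve 3 (λ x y z → x :* y :- x :* z := x :* (y :- z)) refl
                       (seq x n) (seq y n) (seq z n)))
                     (ℚ.∣p*q∣≡∣p∣*∣q∣ (seq x n) (seq y n ℚ.- seq z n))))
         (trans (solve 3 (λ b e i → b :* (e :* i) := e :* (b :* i)) refl B ε (inv B))
           (trans (cong (ε ℚ.*_) (inv-inverse 0<B)) (ℚ.*-identityʳ ε)))
         (ℚ.≤-<-trans
           (ℚ.*-monoʳ-≤-nonNeg _ {{ℚ.∣-∣-nonNeg (seq y n ℚ.- seq z n)}} b)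
           (ℚ.*-monoʳ-<-pos B {{ℚ.positive 0<B}} k)))
       bound (h (ε ℚ.* inv B) (*-pos 0<ε (inv-pos 0<B)))
    where open ℚ-Solver

  *-comm : ∀ x y → x * y ≈ y * x
  *-comm x y = pointwise λ n → ℚ.*-comm (seq x n) (seq y n)

  *-cong : x ≈ y → z ≈ w → x * z ≈ y * w
  *-cong {x} {y} {z} {w} p q =
    ≈-trans (*-congˡ x q) (≈-trans (*-comm x w) (≈-trans (*-congˡ w p) (*-comm w y)))

  <⇒≤ : x < y → x ≤ y
  <⇒≤ {x} {y} (mk< δ 0<δ (N , h)) = eventually-≤ (N , λ n N≤n →
    ℚ.≤-trans (ℚ.<⇒≤ (p<p+ε (seq x n) 0<δ)) (h n N≤n))

  <-irrefl : ¬ (x < x)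
  <-irrefl {x} (mk< δ 0<δ (N , h)) =
    ℚ.<-irrefl refl (ℚ.<-≤-trans (p<p+ε (seq x N) 0<δ) (h N ℕ.≤-refl))

  ≤-<-trans : x ≤ y → y < z → x < z
  ≤-<-trans {x} {y} {z} (mk≤ x≤y) (mk< δ 0<δ y<z) = mk< (δ ℚ.* ℚ.½) (½-pos 0<δ)
    (both (λ n p q → ℚ.≤-trans (ℚ.+-monoˡ-≤ (δ ℚ.* ℚ.½) p)
        (subst (ℚ._≤ seq z n)
          (trans (cong (seq y n ℚ.+_) (sym (½+½ δ))) (sym (ℚ.+-assoc (seq y n) _ _))) q))
      (x≤y (δ ℚ.* ℚ.½) (½-pos 0<δ)) y<z)

  ≤⇒≯ : x ≤ y → ¬ (y < x)
  ≤⇒≯ x≤y y<x = <-irrefl (<-≤-trans y<x x≤y)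

  -- Rational terms can be compared decidably at a single index `N`, and the Cauchy property carries
  -- the outcome to all later indices: one outcome is the wanted estimate, the other produces a
  -- witness of `y < x`.
  ≮⇒≥ : ¬ (y < x) → x ≤ y
  ≮⇒≥ {y} {x} y≮x = mk≤ λ ε 0<ε → go ε (*-pos 0<ε (0</ 0 4))
    where
      open ℚ-Solver
      -- With `η = ε/5` and threshold `3η` at index `N`, each of the two sequences may drift by `η`:
      -- the first outcome leaves an error of `5η = ε`, the second a gap of `η`.
      ⅕ : ℚ.ℚ
      ⅕ = + 1 ℚ./ 5
      go : ∀ ε → ℚ.0ℚ ℚ.< ε ℚ.* ⅕ → Eventually λ n → seq x n ℚ.≤ seq y n ℚ.+ ε
      go ε 0<η with cauchy x (ε ℚ.* ⅕) 0<η | cauchy y (ε ℚ.* ⅕) 0<η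
      ... | N₁ , h₁ | N₂ , h₂ = decide (seq x N ℚ.≤? seq y N ℚ.+ (η ℚ.+ η ℚ.+ η))
        where
          N : ℕ.ℕ
          N = N₁ ℕ.⊔ N₂
          η : ℚ.ℚ
          η = ε ℚ.* ⅕
          near-x : ∀ m n → N ℕ.≤ m → N ℕ.≤ n → seq x m ℚ.< seq x n ℚ.+ η
          near-x m n N≤m N≤n = close⇒<+ (seq x m) (seq x n)
            (h₁ m n (ℕ.m⊔n≤o⇒m≤o N₁ N₂ N≤m) (ℕ.m⊔n≤o⇒m≤o N₁ N₂ N≤n))
          near-y : ∀ m n → N ℕ.≤ m → N ℕ.≤ n → seq y m ℚ.< seq y n ℚ.+ η
          near-y m n N≤m N≤n = close⇒<+ (seq y m) (seq y n)
            (h₂ m n (ℕ.m⊔n≤o⇒n≤o N₁ N₂ N≤m) (ℕ.m⊔n≤o⇒n≤o N₁ N₂ N≤n))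
          decide : Dec (seq x N ℚ.≤ seq y N ℚ.+ (η ℚ.+ η ℚ.+ η)) →
                   Eventually λ n → seq x n ℚ.≤ seq y n ℚ.+ ε
          decide (yes x≤y) = N , λ n N≤n → ℚ.<⇒≤ (begin-strict
            seq x n                              <⟨ near-x n N N≤n ℕ.≤-refl ⟩
            seq x N ℚ.+ η                        ≤⟨ ℚ.+-monoˡ-≤ η x≤y ⟩
            seq y N ℚ.+ (η ℚ.+ η ℚ.+ η) ℚ.+ η
              <⟨ ℚ.+-monoˡ-< η (ℚ.+-monoˡ-< (η ℚ.+ η ℚ.+ η) (near-y N n ℕ.≤-refl N≤n)) ⟩
            seq y n ℚ.+ η ℚ.+ (η ℚ.+ η ℚ.+ η) ℚ.+ η
              ≡⟨ solve 2 (λ y e → y :+ e :* con ⅕ :+ (e :* con ⅕ :+ e :* con ⅕ :+ e :* con ⅕)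
                              :+ e :* con ⅕ := y :+ e) refl (seq y n) ε ⟩
            seq y n ℚ.+ ε                        ∎)
            where open ℚ.≤-Reasoning
          decide (no x≰y) = contradiction (mk< η 0<η (N , λ n N≤n → ℚ.<⇒≤ (begin-strict
            seq y n ℚ.+ η                        <⟨ ℚ.+-monoˡ-< η (near-y n N N≤n ℕ.≤-refl) ⟩
            seq y N ℚ.+ η ℚ.+ η
              ≡⟨ solve 2 (λ y h → y :+ h :+ h := y :+ (h :+ h :+ h) :- h) refl (seq y N) η ⟩
            seq y N ℚ.+ (η ℚ.+ η ℚ.+ η) ℚ.- η    <⟨ ℚ.+-monoˡ-< (ℚ.- η) (ℚ.≰⇒> x≰y) ⟩
            seq x N ℚ.- η                        <⟨ ℚ.+-monoˡ-< (ℚ.- η) (near-x N n ℕ.≤-refl N≤n) ⟩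
            seq x n ℚ.+ η ℚ.- η                  ≡⟨ solve 2 (λ x h → x :+ h :- h := x) refl (seq x n) η ⟩
            seq x n                              ∎))) y≮x
            where open ℚ.≤-Reasoning

  -- Under `b < a` both branches refute their hypotheses, yet refuting `x ≤ y` also refutes `x < y`,
  -- which by `≮⇒≥` gives `y ≤ x`.
  ≤-cases : ∀ x y → (x ≤ y → a ≤ b) → (y ≤ x → a ≤ b) → a ≤ b
  ≤-cases x y f g = ≮⇒≥ λ b<a →
    let x≰y x≤y = ≤⇒≯ (f x≤y) b<a
    in ≤⇒≯ (g (≮⇒≥ λ x<y → x≰y (<⇒≤ x<y))) b<a

  <⇒0<- : x < y → 0ℝ < y - x
  <⇒0<- {x} {y} (mk< δ 0<δ (N , h)) = mk< δ 0<δ (N , λ n N≤n →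
    subst (ℚ._≤ seq y n ℚ.- seq x n)
      (solve 2 (λ x d → x :+ d :- x := con ℚ.0ℚ :+ d) refl (seq x n) δ)
      (ℚ.+-monoˡ-≤ (ℚ.- seq x n) (h n N≤n)))
    where open ℚ-Solver

  0<* : 0ℝ < x → 0ℝ < y → 0ℝ < x * y
  0<* {x} {y} 0<x@(mk< δ 0<δ _) 0<y@(mk< ε 0<ε _) = mk< (δ ℚ.* ε) (*-pos 0<δ 0<ε)
    (both (λ n p q → subst (ℚ._≤ seq x n ℚ.* seq y n) (sym (ℚ.+-identityˡ _))
        (*-mono-≤ (ℚ.<⇒≤ 0<δ) p (ℚ.<⇒≤ 0<ε) q))
      (away-from-0 0<x) (away-from-0 0<y))

  -- The terms agree only from some index on: earlier terms of `y` may be 0, where `inv` takes the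
  -- default value 0.
  ÷-* : (0<y : 0ℝ < y) → (x ÷ y [ 0<y ]) * y ≈ x
  ÷-* {y} {x} 0<y with away-from-0 0<y
  ... | N , h = eventually-≡⇒≈ (N , λ n N≤n → let open ℚ-Solver in
    trans (solve 3 (λ x i y → x :* i :* y := x :* (y :* i)) refl (seq x n) (inv (seq y n)) (seq y n))
      (trans (cong (seq x n ℚ.*_) (inv-inverse (ℚ.<-≤-trans (_<_.gap-pos 0<y) (h n N≤n))))
        (ℚ.*-identityʳ (seq x n))))

  0≤√ : ∀ x → 0ℝ ≤ √ x
  0≤√ x = eventually-≤ (0 , λ n _ → sqrtApprox-nonNeg n (seq x n))

-- The commutative ring of reals and its solver.

ℝ-commutativeRing : CommutativeRing 0ℓ 0ℓ
ℝ-commutativeRing = record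
  { Carrier = ℝ
  ; _≈_ = _≈_
  ; _+_ = _+_
  ; _*_ = _*_
  ; -_ = -_
  ; 0# = 0ℝ
  ; 1# = 1ℝ
  ; isCommutativeRing = record
    { isRing = record
      { +-isAbelianGroup = record
        { isGroup = record
          { isMonoid = record
            { isSemigroup = record
              { isMagma = record
                { isEquivalence = record { refl = ≈-refl ; sym = ≈-sym ; trans = ≈-trans }
                ; ∙-cong = +-cong
                }
              ; assoc = λ x y z → pointwise λ n → ℚ.+-assoc (seq x n) (seq y n) (seq z n)
              }
            ; identity = (λ x → pointwise λ n → ℚ.+-identityˡ (seq x n))
                       , (λ x → pointwise λ n → ℚ.+-identityʳ (seq x n))
            }
          ; inverse = (λ x → pointwise λ n → ℚ.+-inverseˡ (seq x n))
                    , (λ x → pointwise λ n → ℚ.+-inverseʳ (seq x n))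
          ; ⁻¹-cong = neg-cong
          }
        ; comm = λ x y → pointwise λ n → ℚ.+-comm (seq x n) (seq y n)
        }
      ; *-cong = *-cong
      ; *-assoc = λ x y z → pointwise λ n → ℚ.*-assoc (seq x n) (seq y n) (seq z n)
      ; *-identity = (λ x → pointwise λ n → ℚ.*-identityˡ (seq x n))
                   , (λ x → pointwise λ n → ℚ.*-identityʳ (seq x n))
      ; distrib = (λ x y z → pointwise λ n → ℚ.*-distribˡ-+ (seq x n) (seq y n) (seq z n))
                , (λ x y z → pointwise λ n → ℚ.*-distribʳ-+ (seq x n) (seq y n) (seq z n))
      }
    ; *-comm = *-comm
    }
  }

ℝ-almostCommutativeRing : AlmostCommutativeRing 0ℓ 0ℓ
ℝ-almostCommutativeRing = fromCommutativeRing ℝ-commutativeRing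

-- Coefficients are taken in ℚ, where equality is decidable, so that the solver can normalise
-- identities containing fractions such as ⅛.
fromℚ-morphism : ℚ.+-*-rawRing -Raw-AlmostCommutative⟶ ℝ-almostCommutativeRing
fromℚ-morphism = record
  { ⟦_⟧ = fromℚ
  ; +-homo = λ _ _ → pointwise λ _ → refl
  ; *-homo = λ _ _ → pointwise λ _ → refl
  ; -‿homo = λ _ → pointwise λ _ → refl
  ; 0-homo = ≈-refl
  ; 1-homo = ≈-refl
  }

fromℚ-≟ : WeaklyDecidable (Induced-equivalence fromℚ-morphism)
fromℚ-≟ p q = Maybe.map (λ { refl → ≈-refl }) (dec⇒maybe (p ℚ.≟ q))

module ℝ-Solver = RingSolver ℚ.+-*-rawRing ℝ-almostCommutativeRing fromℚ-morphism fromℚ-≟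

open ℝ-Solver using (Polynomial; solve; _:+_; _:*_; _:-_; :-_; _:=_; con)

:0 :1 :4 :½ :¼ :⅛ : ∀ {n} → Polynomial n
:0 = con ℚ.0ℚ
:1 = con ℚ.1ℚ
:4 = con (+ 4 ℚ./ 1)
:½ = con ℚ.½
:¼ = con (+ 1 ℚ./ 4)
:⅛ = con (+ 1 ℚ./ 8)

-- Signs, quotients and square roots.

abstract

  0≤+ : 0ℝ ≤ x → 0ℝ ≤ y → 0ℝ ≤ x + y
  0≤+ 0≤x 0≤y = ≤-trans (≥-from-≈ (pointwise λ _ → refl)) (+-mono-≤ 0≤x 0≤y)

  ≤⇒0≤- : x ≤ y → 0ℝ ≤ y - x
  ≤⇒0≤- {x} {y} x≤y = ≤-trans (≥-from-≈ (solve 1 (λ x → x :- x := :0) ≈-refl x))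
    (+-mono-≤ x≤y ≤-refl)

  0≤⇒≤ : 0ℝ ≤ z → y - x ≈ z → x ≤ y
  0≤⇒≤ {z} {y} {x} 0≤z e = ≤-trans (≥-from-≈ (solve 1 (λ x → :0 :+ x := x) ≈-refl x))
    (≤-trans (+-mono-≤ (≤-trans 0≤z (≥-from-≈ e)) (≤-refl {x}))
      (≈⇒≤ (solve 2 (λ x y → y :- x :+ x := y) ≈-refl x y)))

  -- A nonnegative factor that is not positive equals 0 and makes the product 0. So if the product
  -- were negative, neither factor could fail to be positive, while `0<*` excludes two positive
  -- factors.
  0≤* : 0ℝ ≤ x → 0ℝ ≤ y → 0ℝ ≤ x * y
  0≤* {x} {y} 0≤x 0≤y = ≮⇒≥ λ xy<0 →
    let vanishing : ∀ {s t} → 0ℝ ≤ s → ¬ (0ℝ < s) → t * s < 0ℝ → _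
        vanishing {s} {t} 0≤s 0≮s ts<0 = <-irrefl (<-≤-trans ts<0
          (≤-trans (≥-from-≈ (solve 1 (λ t → t :* :0 := :0) ≈-refl t))
            (≈⇒≤ (*-congˡ t (≤-antisym 0≤s (≮⇒≥ 0≮s))))))
    in vanishing {y} {x} 0≤y
         (λ 0<y → vanishing {x} {y} 0≤x
           (λ 0<x → <-irrefl (<-≤-trans xy<0 (<⇒≤ (0<* 0<x 0<y))))
           (≤-<-trans (≈⇒≤ (*-comm y x)) xy<0))
         xy<0

  -- Later inequalities shed a positive factor this way: a ring identity writes the multiple as a
  -- sum of nonnegative terms.
  *-cancel-0≤ : 0ℝ < a → 0ℝ ≤ a * b → 0ℝ ≤ b
  *-cancel-0≤ {a} {b} 0<a 0≤ab = ≮⇒≥ λ b<0 → <-irrefl (<-≤-trans (0<* 0<a (<⇒0<- b<0))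
    (0≤⇒≤ 0≤ab (solve 2 (λ a b → :0 :- a :* (:0 :- b) := a :* b) ≈-refl a b)))

  ÷-unique : (0<y : 0ℝ < y) → z * y ≈ x → x ÷ y [ 0<y ] ≈ z
  ÷-unique {y} {z} {x} 0<y zy≈x =
    -- The quotient becomes `x` times the reciprocal `1ℝ ÷ y`, which the solver can treat as a
    -- variable.
    ≈-trans (pointwise λ n → cong (seq x n ℚ.*_) (sym (ℚ.*-identityˡ (inv (seq y n)))))
      (≈-trans (*-cong (≈-sym zy≈x) (≈-refl {1ℝ ÷ y [ 0<y ]}))
        (≈-trans (solve 3 (λ z y i → z :* y :* i := z :* (i :* y)) ≈-refl z y (1ℝ ÷ y [ 0<y ]))
          (≈-trans (*-congˡ z (÷-* 0<y)) (solve 1 (λ z → z :* :1 := z) ≈-refl z))))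

  1≤÷ : (0<y : 0ℝ < y) → y ≤ x → 1ℝ ≤ x ÷ y [ 0<y ]
  1≤÷ {y} {x} 0<y y≤x = 0≤⇒≤ (*-cancel-0≤ 0<y (≤-trans (≤⇒0≤- y≤x) (≥-from-≈
    (≈-trans (solve 2 (λ y q → y :* (q :- :1) := q :* y :- y) ≈-refl y (x ÷ y [ 0<y ]))
      (+-cong (÷-* 0<y) ≈-refl))))) ≈-refl

-- The error of √_ at precision n, as a real number: x ≤ (√ x + grid)² holds termwise.
grid : ℝ
grid = mkℝ (λ n → + 1 ℚ./ ℕ.suc n) (mkCauchy λ ε 0<ε → let (N , h) = archimedean 0<ε in
  N , λ m n N≤m _ → ℚ.≤-<-trans (h m N≤m)
    (subst (ℚ._< (+ 1 ℚ./ ℕ.suc n) ℚ.+ ε) (ℚ.+-identityˡ ε) (ℚ.+-monoˡ-< ε (0</ 0 n))))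

abstract

  grid≈0 : grid ≈ 0ℝ
  grid≈0 = ≤-antisym
    (mk≤ λ ε 0<ε → let (N , h) = archimedean 0<ε in
      N , λ n N≤n → subst (_ ℚ.≤_) (sym (ℚ.+-identityˡ ε)) (h n N≤n))
    (mk≤ λ ε 0<ε → 0 , λ n _ → ℚ.+-mono-≤ (0≤/ 1 n) (ℚ.<⇒≤ 0<ε))

  -- Rounding down gives the upper bound on the square; the lower bound holds termwise after adding
  -- `grid`, which vanishes in the limit.
  √-² : 0ℝ ≤ x → (√ x) ² ≈ x
  √-² {x} (mk≤ 0≤x) = ≤-antisym
    (mk≤ λ ε 0<ε → let (N , h) = 0≤x ε 0<ε in N , λ n N≤n →
      lower ε 0<ε n (h n N≤n) (sqrtApprox-lower n (seq x n)))
    (≤-trans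
      (eventually-≤ {y = (√ x + grid) ²} (0 , λ n _ → ℚ.<⇒≤ (sqrtApprox-upper n (seq x n))))
      (≈⇒≤ (*-cong √+grid √+grid)))
    where
      √+grid : √ x + grid ≈ √ x
      √+grid = ≈-trans (+-cong ≈-refl grid≈0) (solve 1 (λ s → s :+ :0 := s) ≈-refl (√ x))
      lower : ∀ ε → ℚ.0ℚ ℚ.< ε → ∀ n → ℚ.0ℚ ℚ.≤ seq x n ℚ.+ ε →
              seq (√ x) n ≡ ℚ.0ℚ ⊎ seq (√ x) n ℚ.* seq (√ x) n ℚ.≤ seq x n →
              seq (√ x) n ℚ.* seq (√ x) n ℚ.≤ seq x n ℚ.+ ε
      -- Terms of a nonnegative real may be negative and then have the default root 0; the slack `ε`
      -- absorbs this.
      lower ε 0<ε n 0≤ (inj₁ s≡0) = subst (λ s → s ℚ.* s ℚ.≤ seq x n ℚ.+ ε) (sym s≡0) 0≤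
      lower ε 0<ε n 0≤ (inj₂ s²≤) = ℚ.≤-trans s²≤ (ℚ.<⇒≤ (p<p+ε (seq x n) 0<ε))

  ≤-respˡ-≈ : x ≈ z → z ≤ y → x ≤ y
  ≤-respˡ-≈ x≈z z≤y = ≤-trans (≈⇒≤ x≈z) z≤y

  0<1+ : 0ℝ ≤ x → 0ℝ < 1ℝ + x
  0<1+ {x} 0≤x = <-≤-trans (mk< ℚ.1ℚ (0</ 0 0) (0 , λ _ _ → ℚ.≤-refl))
    (0≤⇒≤ 0≤x (solve 1 (λ x → :1 :+ x :- :1 := x) ≈-refl x))

-- Lower bounds for products with given excess.

-- (1 + h)(1 + k) − 1
excess : ℝ → ℝ → ℝ
excess h k = h + k + h * k

abstract

  -- With `A` and `A*` for the two excesses, `(h - h*)(k - h*) + h*(A - A*) = (1 + h*)(hk - h*k*)`,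
  -- and every term on the left is nonnegative.
  product-mono : ∀ {h k h* k*} → 0ℝ ≤ h* → h* ≤ h → h ≤ k → excess h* k* ≤ excess h k →
                 h* * k* ≤ h * k
  product-mono {h} {k} {h*} {k*} 0≤h* h*≤h h≤k A*≤A = 0≤⇒≤
    (*-cancel-0≤ (0<1+ 0≤h*) (≤-trans
      (0≤+ (0≤* (≤⇒0≤- h*≤h) (≤⇒0≤- (≤-trans h*≤h h≤k))) (0≤* 0≤h* (≤⇒0≤- A*≤A)))
      (≈⇒≤ (solve 4 (λ h k h* k* →
        (h :- h*) :* (k :- h*) :+ h* :* ((h :+ k :+ h :* k) :- (h* :+ k* :+ h* :* k*))
          := (:1 :+ h*) :* (h :* k :- h* :* k*)) ≈-refl h k h* k*))))
    ≈-refl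

  -- The two sides differ by `2hh*(k - k*)`, and `k* ≤ k` because `(1 + h)(k - k*)` is the
  -- difference of the excesses plus `(1 + k*)(h* - h)`. The identity below combines both facts.
  product-chord : ∀ {h k h* k*} → 0ℝ ≤ h → 0ℝ ≤ h* → 0ℝ ≤ k* → h ≤ h* →
                  excess h* k* ≤ excess h k →
                  h* * k* * (h * k + (h + h)) ≤ h * k * (h* * k* + (h* + h*))
  product-chord {h} {k} {h*} {k*} 0≤h 0≤h* 0≤k* h≤h* A*≤A = 0≤⇒≤
    (*-cancel-0≤ (0<1+ 0≤h) (≤-trans
      (0≤* (0≤+ (0≤* 0≤h 0≤h*) (0≤* 0≤h 0≤h*))
        (0≤+ (≤⇒0≤- A*≤A) (0≤* (<⇒≤ (0<1+ 0≤k*)) (≤⇒0≤- h≤h*))))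
      (≈⇒≤ (solve 4 (λ h k h* k* →
        (h :* h* :+ h :* h*) :*
            (((h :+ k :+ h :* k) :- (h* :+ k* :+ h* :* k*)) :+ (:1 :+ k*) :* (h* :- h))
          := (:1 :+ h) :*
            (h :* k :* (h* :* k* :+ (h* :+ h*)) :- h* :* k* :* (h :* k :+ (h :+ h))))
        ≈-refl h k h* k*))))
    ≈-refl

  -- Here `e` plays |p - q|, presented by a choice of sign, so that `excess p q - e` is `hk + 2h`
  -- for the ordered pair. The continuations end in `a ≤ b` because `≤-cases` splits only for such a
  -- goal.
  product-cases : ∀ {p q h* k*} → 0ℝ ≤ p → 0ℝ ≤ q → 0ℝ ≤ h* → 0ℝ ≤ k* → excess h* k* ≤ excess p q →
    (h* * k* ≤ p * q → a ≤ b) →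
    (∀ e → e ≈ p - q ⊎ e ≈ - (p - q) →
      h* * k* * (excess p q - e) ≤ p * q * (h* * k* + (h* + h*)) → a ≤ b) →
    a ≤ b
  product-cases {p = p} {q} {h*} {k*} 0≤p 0≤q 0≤h* 0≤k* A*≤A large chord =
    ≤-cases p q
      (λ p≤q → ≤-cases h* p
        (λ h*≤p → large (product-mono 0≤h* h*≤p p≤q A*≤A))
        (λ p≤h* → chord (- (p - q)) (inj₂ ≈-refl)
          (≤-respˡ-≈ (*-congˡ (h* * k*) (solve 2
              (λ p q → (p :+ q :+ p :* q) :- (:- (p :- q)) := p :* q :+ (p :+ p)) ≈-refl p q))
            (product-chord 0≤p 0≤h* 0≤k* p≤h* A*≤A))))
      (λ q≤p → ≤-cases h* q
        (λ h*≤q → large (≤-trans (product-mono 0≤h* h*≤q q≤p A*≤A′) (≈⇒≤ (*-comm q p))))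
        (λ q≤h* → chord (p - q) (inj₁ ≈-refl)
          (≤-respˡ-≈ (*-congˡ (h* * k*) (solve 2
              (λ p q → (p :+ q :+ p :* q) :- (p :- q) := q :* p :+ (q :+ q)) ≈-refl p q))
            (≤-trans (product-chord 0≤q 0≤h* 0≤k* q≤h* A*≤A′)
              (≈⇒≤ (*-cong (*-comm q p) ≈-refl))))))
    where
      A*≤A′ : excess h* k* ≤ excess q p
      A*≤A′ = ≤-trans A*≤A (≈⇒≤ (solve 2 (λ p q → p :+ q :+ p :* q := q :+ p :+ q :* p) ≈-refl p q))

  -- In |x| + |y| + |z| two of the signs agree, so up to a global sign it is x + y + z, or
  -- x + y + z with one of the terms subtracted twice.
  abs-sum-≤ : ∀ {b c x y z e f g} → 0ℝ ≤ b →
    x ≤ b → y ≤ b → z ≤ b → - x ≤ b → - y ≤ b → - z ≤ b → x + y + z ≤ c → - (x + y + z) ≤ c →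
    e ≈ x ⊎ e ≈ - x → f ≈ y ⊎ f ≈ - y → g ≈ z ⊎ g ≈ - z →
    e + f + g ≤ c + (b + b)
  abs-sum-≤ {b} {c} {x} {y} {z} {e} {f} {g} 0≤b x≤b y≤b z≤b -x≤b -y≤b -z≤b Σ≤c -Σ≤c = go
    where
      bound : ∀ {s t e′ f′ g′} → e ≈ e′ → f ≈ f′ → g ≈ g′ → e′ + f′ + g′ ≈ s + (t + t) →
              s ≤ c → t ≤ b → e + f + g ≤ c + (b + b)
      bound e≈ f≈ g≈ Σ≈ s≤c t≤b =
        ≤-respˡ-≈ (≈-trans (+-cong (+-cong e≈ f≈) g≈) Σ≈)
          (+-mono-≤ s≤c (+-mono-≤ t≤b t≤b))
      go : e ≈ x ⊎ e ≈ - x → f ≈ y ⊎ f ≈ - y → g ≈ z ⊎ g ≈ - z → e + f + g ≤ c + (b + b)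
      go (inj₁ p) (inj₁ q) (inj₁ r) = bound p q r
        (solve 3 (λ x y z → x :+ y :+ z := x :+ y :+ z :+ (:0 :+ :0)) ≈-refl x y z)
        Σ≤c 0≤b
      go (inj₁ p) (inj₁ q) (inj₂ r) = bound p q r
        (solve 3 (λ x y z → x :+ y :+ :- z := x :+ y :+ z :+ (:- z :+ :- z)) ≈-refl x y z)
        Σ≤c -z≤b
      go (inj₁ p) (inj₂ q) (inj₁ r) = bound p q r
        (solve 3 (λ x y z → x :+ :- y :+ z := x :+ y :+ z :+ (:- y :+ :- y)) ≈-refl x y z)
        Σ≤c -y≤b
      go (inj₂ p) (inj₁ q) (inj₁ r) = bound p q r
        (solve 3 (λ x y z → :- x :+ y :+ z := x :+ y :+ z :+ (:- x :+ :- x)) ≈-refl x y z)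
        Σ≤c -x≤b
      go (inj₁ p) (inj₂ q) (inj₂ r) = bound p q r
        (solve 3 (λ x y z → x :+ :- y :+ :- z := :- (x :+ y :+ z) :+ (x :+ x)) ≈-refl x y z)
        -Σ≤c x≤b
      go (inj₂ p) (inj₁ q) (inj₂ r) = bound p q r
        (solve 3 (λ x y z → :- x :+ y :+ :- z := :- (x :+ y :+ z) :+ (y :+ y)) ≈-refl x y z)
        -Σ≤c y≤b
      go (inj₂ p) (inj₂ q) (inj₁ r) = bound p q r
        (solve 3 (λ x y z → :- x :+ :- y :+ z := :- (x :+ y :+ z) :+ (z :+ z)) ≈-refl x y z)
        -Σ≤c z≤b
      go (inj₂ p) (inj₂ q) (inj₂ r) = bound p q r
        (solve 3 (λ x y z → :- x :+ :- y :+ :- z := :- (x :+ y :+ z) :+ (:0 :+ :0)) ≈-refl x y z)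
        -Σ≤c 0≤b

  diff≤excess : ∀ {p q} → 0ℝ ≤ p → 0ℝ ≤ q → p - q ≤ excess p q
  diff≤excess {p} {q} 0≤p 0≤q = 0≤⇒≤ (0≤+ (0≤+ 0≤q 0≤q) (0≤* 0≤p 0≤q))
    (solve 2 (λ p q → p :+ q :+ p :* q :- (p :- q) := q :+ q :+ p :* q) ≈-refl p q)

  -diff≤excess : ∀ {p q} → 0ℝ ≤ p → 0ℝ ≤ q → - (p - q) ≤ excess p q
  -diff≤excess {p} {q} 0≤p 0≤q = 0≤⇒≤ (0≤+ (0≤+ 0≤p 0≤p) (0≤* 0≤p 0≤q))
    (solve 2 (λ p q → p :+ q :+ p :* q :- (:- (p :- q)) := p :+ p :+ p :* q) ≈-refl p q)

  -- One product of at least `h* * k*` settles the claim, as the others are nonnegative. What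
  -- remains is the case in which all of the first three objectives lie above the chord.
  sum-product-≥ : ∀ {p₁ q₁ p₂ q₂ p₃ q₃ p₄ q₄ h* k*} →
    0ℝ ≤ p₁ → 0ℝ ≤ q₁ → 0ℝ ≤ p₂ → 0ℝ ≤ q₂ → 0ℝ ≤ p₃ → 0ℝ ≤ q₃ → 0ℝ ≤ p₄ → 0ℝ ≤ q₄ →
    0ℝ ≤ h* → 0ℝ ≤ k* →
    excess p₂ q₂ ≤ excess p₁ q₁ → excess p₃ q₃ ≤ excess p₂ q₂ → excess h* k* ≈ excess p₃ q₃ →
    (p₁ - q₁) + (p₂ - q₂) + (p₃ - q₃) ≈ q₄ - p₄ →
    h* * k* + (h* + h*) ≈ excess p₂ q₂ + excess p₃ q₃ - excess p₁ q₁ - excess p₄ q₄ →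
    0ℝ < h* * k* + (h* + h*) →
    h* * k* ≤ p₁ * q₁ + p₂ * q₂ + p₃ * q₃ + p₄ * q₄
  sum-product-≥ {p₁} {q₁} {p₂} {q₂} {p₃} {q₃} {p₄} {q₄} {h*} {k*}
    0≤p₁ 0≤q₁ 0≤p₂ 0≤q₂ 0≤p₃ 0≤q₃ 0≤p₄ 0≤q₄ 0≤h* 0≤k* A₂≤A₁ A₃≤A₂ A*≈A₃ balance δ≈ 0<δ =
    product-cases 0≤p₁ 0≤q₁ 0≤h* 0≤k* (≤-trans A*≤A₂ A₂≤A₁)
      (λ ψ≤ → 0≤⇒≤ (0≤+ (0≤+ (0≤+ (≤⇒0≤- ψ≤) 0≤ψ₂) 0≤ψ₃) 0≤ψ₄)
        (solve 5 (λ s a b c d → a :+ b :+ c :+ d :- s := a :- s :+ b :+ c :+ d) ≈-refl ψ* ψ₁ ψ₂ ψ₃ ψ₄))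
      λ e₁ e₁≈ chord₁ → product-cases 0≤p₂ 0≤q₂ 0≤h* 0≤k* A*≤A₂
      (λ ψ≤ → 0≤⇒≤ (0≤+ (0≤+ (0≤+ (≤⇒0≤- ψ≤) 0≤ψ₁) 0≤ψ₃) 0≤ψ₄)
        (solve 5 (λ s a b c d → a :+ b :+ c :+ d :- s := b :- s :+ a :+ c :+ d) ≈-refl ψ* ψ₁ ψ₂ ψ₃ ψ₄))
      λ e₂ e₂≈ chord₂ → product-cases 0≤p₃ 0≤q₃ 0≤h* 0≤k* (≈⇒≤ A*≈A₃)
      (λ ψ≤ → 0≤⇒≤ (0≤+ (0≤+ (0≤+ (≤⇒0≤- ψ≤) 0≤ψ₁) 0≤ψ₂) 0≤ψ₄)
        (solve 5 (λ s a b c d → a :+ b :+ c :+ d :- s := c :- s :+ a :+ b :+ d) ≈-refl ψ* ψ₁ ψ₂ ψ₃ ψ₄))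
      -- The largest excess `A₁` bounds each single difference; `A₄` bounds their signed sum, which
      -- the balance equates to `q₄ - p₄`.
      λ e₃ e₃≈ chord₃ → combine chord₁ chord₂ chord₃ (abs-sum-≤
        (0≤+ (0≤+ 0≤p₁ 0≤q₁) 0≤ψ₁)
        (diff≤excess 0≤p₁ 0≤q₁)
        (≤-trans (diff≤excess 0≤p₂ 0≤q₂) A₂≤A₁)
        (≤-trans (diff≤excess 0≤p₃ 0≤q₃) (≤-trans A₃≤A₂ A₂≤A₁))
        (-diff≤excess 0≤p₁ 0≤q₁)
        (≤-trans (-diff≤excess 0≤p₂ 0≤q₂) A₂≤A₁)
        (≤-trans (-diff≤excess 0≤p₃ 0≤q₃) (≤-trans A₃≤A₂ A₂≤A₁))
        (≤-respˡ-≈ (≈-trans balance (solve 2 (λ p q → q :- p := :- (p :- q)) ≈-refl p₄ q₄))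
          (-diff≤excess 0≤p₄ 0≤q₄))
        (≤-respˡ-≈ (≈-trans (neg-cong balance) (solve 2 (λ p q → :- (q :- p) := p :- q) ≈-refl p₄ q₄))
          (diff≤excess 0≤p₄ 0≤q₄))
        e₁≈ e₂≈ e₃≈)
    where
      ψ₁ ψ₂ ψ₃ ψ₄ ψ* δ A₁ A₂ A₃ A₄ : ℝ
      ψ₁ = p₁ * q₁
      ψ₂ = p₂ * q₂
      ψ₃ = p₃ * q₃
      ψ₄ = p₄ * q₄
      ψ* = h* * k*
      δ = h* * k* + (h* + h*)
      A₁ = excess p₁ q₁
      A₂ = excess p₂ q₂
      A₃ = excess p₃ q₃
      A₄ = excess p₄ q₄
      0≤ψ₁ : 0ℝ ≤ ψ₁
      0≤ψ₁ = 0≤* 0≤p₁ 0≤q₁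
      0≤ψ₂ : 0ℝ ≤ ψ₂
      0≤ψ₂ = 0≤* 0≤p₂ 0≤q₂
      0≤ψ₃ : 0ℝ ≤ ψ₃
      0≤ψ₃ = 0≤* 0≤p₃ 0≤q₃
      0≤ψ₄ : 0ℝ ≤ ψ₄
      0≤ψ₄ = 0≤* 0≤p₄ 0≤q₄
      A*≤A₂ : excess h* k* ≤ A₂
      A*≤A₂ = ≤-trans (≈⇒≤ A*≈A₃) A₃≤A₂
      combine : ∀ {e₁ e₂ e₃} →
        ψ* * (A₁ - e₁) ≤ ψ₁ * δ → ψ* * (A₂ - e₂) ≤ ψ₂ * δ → ψ* * (A₃ - e₃) ≤ ψ₃ * δ →
        e₁ + e₂ + e₃ ≤ A₄ + (A₁ + A₁) → ψ* ≤ ψ₁ + ψ₂ + ψ₃ + ψ₄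
      combine {e₁} {e₂} {e₃} chord₁ chord₂ chord₃ Σe≤ = 0≤⇒≤
        (*-cancel-0≤ 0<δ (≤-trans
          (0≤+ (0≤+ (0≤+ (≤⇒0≤- chord₁) (≤⇒0≤- chord₂)) (≤⇒0≤- chord₃))
            (0≤+ (0≤* (<⇒≤ 0<δ) 0≤ψ₄) (0≤* (0≤* 0≤h* 0≤k*) 0≤slack)))
          (≈⇒≤ (solve 12 (λ a₁ a₂ a₃ e₁ e₂ e₃ w₁ w₂ w₃ w₄ s d →
            (w₁ :* d :- s :* (a₁ :- e₁)) :+ (w₂ :* d :- s :* (a₂ :- e₂)) :+ (w₃ :* d :- s :* (a₃ :- e₃))
              :+ (d :* w₄ :+ s :* ((a₁ :- e₁) :+ (a₂ :- e₂) :+ (a₃ :- e₃) :- d))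
              := d :* (w₁ :+ w₂ :+ w₃ :+ w₄ :- s))
            ≈-refl A₁ A₂ A₃ e₁ e₂ e₃ ψ₁ ψ₂ ψ₃ ψ₄ ψ* δ))))
        ≈-refl
        where
          -- This is the bound on `e₁ + e₂ + e₃` rearranged, with `δ` replaced by
          -- `A₂ + A₃ - A₁ - A₄`.
          0≤slack : 0ℝ ≤ (A₁ - e₁) + (A₂ - e₂) + (A₃ - e₃) - δ
          0≤slack = ≤-trans (≤⇒0≤- Σe≤) (≈⇒≤ (≈-trans
            (solve 7 (λ a₁ a₂ a₃ a₄ e₁ e₂ e₃ →
              (a₄ :+ (a₁ :+ a₁)) :- (e₁ :+ e₂ :+ e₃)
                := (a₁ :- e₁) :+ (a₂ :- e₂) :+ (a₃ :- e₃) :- (a₂ :+ a₃ :- a₁ :- a₄))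
              ≈-refl A₁ A₂ A₃ A₄ e₁ e₂ e₃)
            (+-cong ≈-refl (neg-cong (≈-sym δ≈)))))

-- Means of four terms, expressed by ratios and products.

½ℝ ¼ℝ ⅛ℝ : ℝ
½ℝ = fromℚ ℚ.½
¼ℝ = fromℚ (+ 1 ℚ./ 4)
⅛ℝ = fromℚ (+ 1 ℚ./ 8)

abstract

  0≤fromℚ : ∀ {q} → ℚ.0ℚ ℚ.≤ q → 0ℝ ≤ fromℚ q
  0≤fromℚ 0≤q = eventually-≤ (0 , λ _ _ → 0≤q)

  -- The trailing `0ℝ` is the base of the fold, kept so that `mean` unfolds to this form by
  -- computation.
  mean-cong₄ : ∀ (v : Fin 4 → ℝ) {a b c d} → v 0F ≈ a → v 1F ≈ b → v 2F ≈ c → v 3F ≈ d →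
               mean v ≈ ¼ℝ * (a + (b + (c + (d + 0ℝ))))
  mean-cong₄ _ p q r s = *-congˡ ¼ℝ (+-cong p (+-cong q (+-cong r (+-cong s ≈-refl))))

  ÷-chain : (0<y : 0ℝ < y) (0<z : 0ℝ < z) →
            (y ÷ z [ 0<z ]) * (x ÷ y [ 0<y ]) ≈ x ÷ z [ 0<z ]
  ÷-chain {y} {z} {x} 0<y 0<z = ≈-sym (÷-unique 0<z
    (≈-trans (solve 3 (λ t u z → t :* u :* z := u :* (t :* z)) ≈-refl
               (y ÷ z [ 0<z ]) (x ÷ y [ 0<y ]) z)
      (≈-trans (*-congˡ (x ÷ y [ 0<y ]) (÷-* 0<z)) (÷-* 0<y))))

  -- By balance the mean is ⅛ of the sum of all `yᵢ + uᵢ`, and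
  -- `yᵢ + uᵢ = rᵢ + 1 - (yᵢ - 1)(uᵢ - 1)`. Hence the difference of the two sides is ⅛ of the slack
  -- in the last hypothesis.
  mean-≤ : ∀ {y₁ y₂ y₃ y₄ u₁ u₂ u₃ u₄ r₁ r₂ r₃ r₄ S} →
    y₁ * u₁ ≈ r₁ → y₂ * u₂ ≈ r₂ → y₃ * u₃ ≈ r₃ → y₄ * u₄ ≈ r₄ →
    ¼ℝ * (y₁ + (y₂ + (y₃ + (y₄ + 0ℝ)))) ≈ ¼ℝ * (u₁ + (u₂ + (u₃ + (u₄ + 0ℝ)))) →
    r₃ + 1ℝ - S ≤ (y₁ - 1ℝ) * (u₁ - 1ℝ) + (y₂ - 1ℝ) * (u₂ - 1ℝ)
                + (y₃ - 1ℝ) * (u₃ - 1ℝ) + (y₄ - 1ℝ) * (u₄ - 1ℝ) →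
    ¼ℝ * (u₁ + (u₂ + (u₃ + (u₄ + 0ℝ)))) ≤ ⅛ℝ * (S + (r₁ + 1ℝ) + (r₂ + 1ℝ) + (r₄ + 1ℝ))
  mean-≤ {y₁} {y₂} {y₃} {y₄} {u₁} {u₂} {u₃} {u₄} {r₁} {r₂} {r₃} {r₄} {S} e₁ e₂ e₃ e₄ bal h =
    0≤⇒≤ (0≤* (0≤fromℚ {+ 1 ℚ./ 8} (0≤/ 1 7)) (≤⇒0≤- h)) (≈-trans
      (+-cong
        (*-congˡ ⅛ℝ (+-cong (+-cong (+-cong ≈-refl (+-cong (≈-sym e₁) ≈-refl))
          (+-cong (≈-sym e₂) ≈-refl)) (+-cong (≈-sym e₄) ≈-refl)))
        (neg-cong (≈-trans
          (solve 1 (λ m → m := :½ :* m :+ :½ :* m) ≈-refl (¼ℝ * (u₁ + (u₂ + (u₃ + (u₄ + 0ℝ))))))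
          (+-cong (*-congˡ ½ℝ (≈-sym bal)) ≈-refl))))
      (≈-trans
        (solve 9 (λ y₁ y₂ y₃ y₄ u₁ u₂ u₃ u₄ S →
          :⅛ :* (S :+ (y₁ :* u₁ :+ :1) :+ (y₂ :* u₂ :+ :1) :+ (y₄ :* u₄ :+ :1))
            :- (:½ :* (:¼ :* (y₁ :+ (y₂ :+ (y₃ :+ (y₄ :+ :0)))))
                :+ :½ :* (:¼ :* (u₁ :+ (u₂ :+ (u₃ :+ (u₄ :+ :0))))))
            := :⅛ :*
               ((y₁ :- :1) :* (u₁ :- :1) :+ (y₂ :- :1) :* (u₂ :- :1)
                :+ (y₃ :- :1) :* (u₃ :- :1) :+ (y₄ :- :1) :* (u₄ :- :1)
                :- (y₃ :* u₃ :+ :1 :- S)))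
          ≈-refl y₁ y₂ y₃ y₄ u₁ u₂ u₃ u₄ S)
        (*-congˡ ⅛ℝ (+-cong ≈-refl (neg-cong (+-cong (+-cong e₃ ≈-refl) ≈-refl))))))

  excess-pred : ∀ {r} → x * y ≈ r → excess (x - 1ℝ) (y - 1ℝ) ≈ r - 1ℝ
  excess-pred {x} {y} e = ≈-trans
    (solve 2 (λ x y → (x :- :1) :+ (y :- :1) :+ (x :- :1) :* (y :- :1)
                := x :* y :- :1) ≈-refl x y)
    (+-cong e ≈-refl)

  balance-pred : ∀ {y₁ y₂ y₃ y₄ u₁ u₂ u₃ u₄} →
    ¼ℝ * (y₁ + (y₂ + (y₃ + (y₄ + 0ℝ)))) ≈ ¼ℝ * (u₁ + (u₂ + (u₃ + (u₄ + 0ℝ)))) →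
    ((y₁ - 1ℝ) - (u₁ - 1ℝ)) + ((y₂ - 1ℝ) - (u₂ - 1ℝ)) + ((y₃ - 1ℝ) - (u₃ - 1ℝ))
      ≈ (u₄ - 1ℝ) - (y₄ - 1ℝ)
  balance-pred {y₁} {y₂} {y₃} {y₄} {u₁} {u₂} {u₃} {u₄} bal = ≈-trans
    (solve 8 (λ y₁ y₂ y₃ y₄ u₁ u₂ u₃ u₄ →
      ((y₁ :- :1) :- (u₁ :- :1)) :+ ((y₂ :- :1) :- (u₂ :- :1)) :+ ((y₃ :- :1) :- (u₃ :- :1))
      := :4 :* (:¼ :* (y₁ :+ (y₂ :+ (y₃ :+ (y₄ :+ :0)))))
         :- :4 :* (:¼ :* (u₁ :+ (u₂ :+ (u₃ :+ (u₄ :+ :0)))))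
         :+ ((u₄ :- :1) :- (y₄ :- :1))) ≈-refl y₁ y₂ y₃ y₄ u₁ u₂ u₃ u₄)
    (≈-trans (+-cong (+-cong (*-congˡ (fromℕ 4) bal) ≈-refl) ≈-refl)
      (solve 2 (λ s t → s :- s :+ t := t) ≈-refl _ _))

-- The upper bound and the point attaining it.

theorem6p3 : (P : PriceIntervals 4) →
    let open PriceIntervals P
        r₁ = fluctuationRatio 0F
        r₂ = fluctuationRatio 1F
        r₃ = fluctuationRatio 2F
        r₄ = fluctuationRatio 3F
    in r₂ ≤ r₁ → r₃ ≤ r₂ → r₄ ≤ r₃ → 1ℝ ≤ r₄ →
       r₁ - 1ℝ < (r₂ - 1ℝ) + (r₃ - 1ℝ) - (r₄ - 1ℝ) →
       IsCompetitiveRatio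
         (fromℚ (+ 1 ℚ./ 8) *
           (√ (fromℕ 4 * r₃ + ((r₁ - 1ℝ) - (r₂ - 1ℝ) + (r₄ - 1ℝ)) ²)
             + (r₁ + 1ℝ) + (r₂ + 1ℝ) + (r₄ + 1ℝ)))
theorem6p3 P r₂≤r₁ r₃≤r₂ r₄≤r₃ 1≤r₄ gap = record
  { upper = bound
  -- The supremum is attained, so one witness serves every `w`.
  ; approximated = λ w w<z → optimum , <-≤-trans w<z (≥-from-≈ mean-u)
  }
  where
    open PriceIntervals P

    r₁ r₂ r₃ r₄ c S h* k* z* : ℝ
    r₁ = fluctuationRatio 0F
    r₂ = fluctuationRatio 1F
    r₃ = fluctuationRatio 2F
    r₄ = fluctuationRatio 3F
    c = (r₁ - 1ℝ) - (r₂ - 1ℝ) + (r₄ - 1ℝ)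
    S = √ (fromℕ 4 * r₃ + c ²)
    -- `1 + h*` is the positive root of `t² + ct = r₃`, and `1 + k*` is that root plus `c`; their
    -- product is `(S² - c²)/4 = r₃`.
    h* = ½ℝ * (S - c) - 1ℝ
    k* = ½ℝ * (S + c) - 1ℝ
    z* = ⅛ℝ * (S + (r₁ + 1ℝ) + (r₂ + 1ℝ) + (r₄ + 1ℝ))

    0≤c : 0ℝ ≤ c
    0≤c = 0≤+ (≤⇒0≤- (+-mono-≤ r₂≤r₁ ≤-refl)) (≤⇒0≤- 1≤r₄)

    0≤1 : 0ℝ ≤ 1ℝ
    0≤1 = 0≤fromℚ {ℚ.1ℚ} (0≤/ 1 0)

    0≤r₃ : 0ℝ ≤ r₃
    0≤r₃ = ≤-trans 0≤1 (≤-trans 1≤r₄ r₄≤r₃)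

    S²≈ : S ² ≈ fromℕ 4 * r₃ + c ²
    S²≈ = √-² (0≤+ (0≤* (0≤fromℚ {+ 4 ℚ./ 1} (0≤/ 4 0)) 0≤r₃) (0≤* 0≤c 0≤c))

    0<δ : 0ℝ < (r₂ - 1ℝ) + (r₃ - 1ℝ) - (r₄ - 1ℝ) - (r₁ - 1ℝ)
    0<δ = <⇒0<- gap

    -- `S² - (c + 2)²` is four times the gap in the hypothesis, and its factor `S + c + 2` is
    -- positive. This makes `h*` nonnegative, so the third price of the optimum is at least `m 2F`.
    0≤S-c-2 : 0ℝ ≤ S - c - (1ℝ + 1ℝ)
    0≤S-c-2 = *-cancel-0≤
      (0<1+ (0≤+ (0≤+ (0≤√ _) 0≤c) 0≤1))
      (≤-trans (0≤* (0≤fromℚ {+ 4 ℚ./ 1} (0≤/ 4 0)) (<⇒≤ 0<δ)) (≈⇒≤ (≈-trans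
        (solve 4 (λ a₁ a₂ a₃ a₄ → :4 :* (a₂ :+ a₃ :- a₄ :- a₁)
            := :4 :* a₃ :- :4 :* (a₁ :- a₂ :+ a₄))
          ≈-refl (r₁ - 1ℝ) (r₂ - 1ℝ) (r₃ - 1ℝ) (r₄ - 1ℝ))
        (≈-trans
          (solve 2 (λ r c → :4 :* (r :- :1) :- :4 :* c
            := (:4 :* r :+ c :* c) :- (c :+ (:1 :+ :1)) :* (c :+ (:1 :+ :1)))
            ≈-refl r₃ c)
          (≈-trans (+-cong (≈-sym S²≈) ≈-refl)
            (solve 2 (λ S c → S :* S :- (c :+ (:1 :+ :1)) :* (c :+ (:1 :+ :1))
              := (:1 :+ (S :+ c :+ :1)) :* (S :- c :- (:1 :+ :1)))
              ≈-refl S c))))))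

    0≤h* : 0ℝ ≤ h*
    0≤h* = ≤-trans (0≤* (0≤fromℚ {ℚ.½} (0≤/ 1 1)) 0≤S-c-2)
      (≈⇒≤ (solve 2 (λ S c → :½ :* (S :- c :- (:1 :+ :1))
                       := :½ :* (S :- c) :- :1) ≈-refl S c))

    0≤k* : 0ℝ ≤ k*
    0≤k* = ≤-trans (0≤+ 0≤h* 0≤c)
      (≈⇒≤ (solve 2 (λ S c → :½ :* (S :- c) :- :1 :+ c
                       := :½ :* (S :+ c) :- :1) ≈-refl S c))

    [1+h*][1+k*]≈r₃ : (1ℝ + h*) * (1ℝ + k*) ≈ r₃
    [1+h*][1+k*]≈r₃ = ≈-trans
      (solve 2 (λ S c → (:1 :+ (:½ :* (S :- c) :- :1))
                          :* (:1 :+ (:½ :* (S :+ c) :- :1))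
                 := :¼ :* (S :* S :- c :* c)) ≈-refl S c)
      (≈-trans (*-congˡ ¼ℝ (+-cong S²≈ ≈-refl))
        (solve 2 (λ r c → :¼ :* (:4 :* r :+ c :* c :- c :* c) := r)
          ≈-refl r₃ c))

    excess* : excess h* k* ≈ r₃ - 1ℝ
    excess* = ≈-trans
      (solve 2 (λ h k → h :+ k :+ h :* k := (:1 :+ h) :* (:1 :+ k) :- :1)
        ≈-refl h* k*)
      (+-cong [1+h*][1+k*]≈r₃ ≈-refl)

    δ≈ : h* * k* + (h* + h*) ≈ (r₂ - 1ℝ) + (r₃ - 1ℝ) - (r₁ - 1ℝ) - (r₄ - 1ℝ)
    δ≈ = ≈-trans
      (solve 2 (λ h k → h :* k :+ (h :+ h) := (h :+ k :+ h :* k) :- (k :- h)) ≈-refl h* k*)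
      (≈-trans
        (+-cong excess* (neg-cong (solve 2 (λ S c →
          (:½ :* (S :+ c) :- :1) :- (:½ :* (S :- c) :- :1) := c) ≈-refl S c)))
        (solve 4 (λ a₁ a₂ a₃ a₄ → a₃ :- (a₁ :- a₂ :+ a₄) := a₂ :+ a₃ :- a₁ :- a₄)
          ≈-refl (r₁ - 1ℝ) (r₂ - 1ℝ) (r₃ - 1ℝ) (r₄ - 1ℝ)))

    -- As `h* + k* = S - 2`, the threshold in `mean-≤` is the product at the claimed optimum.
    h*k*≈ : r₃ + 1ℝ - S ≈ h* * k*
    h*k*≈ = ≈-trans
      (solve 3 (λ r S c → r :+ :1 :- S
          := (r :- :1) :- ((:½ :* (S :- c) :- :1) :+ (:½ :* (S :+ c) :- :1)))
        ≈-refl r₃ S c)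
      (≈-trans (+-cong (≈-sym excess*) ≈-refl)
        (solve 2 (λ h k → (h :+ k :+ h :* k) :- (h :+ k) := h :* k) ≈-refl h* k*))

    bound : ∀ s → meanRatio s ≤ z*
    bound s = mean-≤ (yu≈r 0F) (yu≈r 1F) (yu≈r 2F) (yu≈r 3F) balanced
      (≤-trans (≈⇒≤ h*k*≈) (sum-product-≥
        (0≤p 0F) (0≤q 0F) (0≤p 1F) (0≤q 1F) (0≤p 2F) (0≤q 2F) (0≤p 3F) (0≤q 3F) 0≤h* 0≤k*
        (excess-mono r₂≤r₁) (excess-mono r₃≤r₂) (≈-trans excess* (≈-sym (excess≈ 2F)))
        (balance-pred balanced)
        (≈-trans δ≈ (≈-sym (+-cong
          (+-cong (+-cong (excess≈ 1F) (excess≈ 2F)) (neg-cong (excess≈ 0F)))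
          (neg-cong (excess≈ 3F)))))
        (<-≤-trans 0<δ (≈⇒≤ (≈-trans
          (solve 4 (λ a b c d → b :+ c :- d :- a := b :+ c :- a :- d) ≈-refl
            (r₁ - 1ℝ) (r₂ - 1ℝ) (r₃ - 1ℝ) (r₄ - 1ℝ))
          (≈-sym δ≈))))))
      where
        open 𝒮 s renaming (x to xₛ)
        -- Subtracting 1 from these gives the pᵢ and qᵢ to which `sum-product-≥` is applied.
        yₛ uₛ : Fin 4 → ℝ
        yₛ i = xₛ i ÷ m i [ 0<m i ]
        uₛ i = M i ÷ xₛ i [ 0<x i ]
        yu≈r : ∀ i → yₛ i * uₛ i ≈ fluctuationRatio i
        yu≈r i = ÷-chain (0<x i) (0<m i)
        0≤p : ∀ i → 0ℝ ≤ yₛ i - 1ℝ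
        0≤p i = ≤⇒0≤- (1≤÷ (0<m i) (m≤x i))
        0≤q : ∀ i → 0ℝ ≤ uₛ i - 1ℝ
        0≤q i = ≤⇒0≤- (1≤÷ (0<x i) (x≤M i))
        excess≈ : ∀ i → excess (yₛ i - 1ℝ) (uₛ i - 1ℝ) ≈ fluctuationRatio i - 1ℝ
        excess≈ i = excess-pred (yu≈r i)
        excess-mono : ∀ {i j} → fluctuationRatio i ≤ fluctuationRatio j →
                    excess (yₛ i - 1ℝ) (uₛ i - 1ℝ) ≤ excess (yₛ j - 1ℝ) (uₛ j - 1ℝ)
        excess-mono {i} {j} r≤r = ≤-trans (≈⇒≤ (excess≈ i))
          (≤-trans (+-mono-≤ r≤r ≤-refl) (≥-from-≈ (excess≈ j)))

    -- With aᵢ = rᵢ - 1, the differences pᵢ - qᵢ are a₁, -a₂, `h* - k*` and a₄, and they cancel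
    -- because `k* - h* = c`. The products pᵢqᵢ vanish at the interval ends, so their sum is exactly
    -- `h* * k*`.
    x* : Fin 4 → ℝ
    x* 0F = M 0F
    x* 1F = m 1F
    x* 2F = (1ℝ + h*) * m 2F
    x* 3F = M 3F

    [1+k*]x*≈M : (1ℝ + k*) * x* 2F ≈ M 2F
    [1+k*]x*≈M = ≈-trans
      (solve 3 (λ h k m → k :* (h :* m) := h :* k :* m) ≈-refl (1ℝ + h*) (1ℝ + k*) (m 2F))
      (≈-trans (*-cong [1+h*][1+k*]≈r₃ ≈-refl) (÷-* (0<m 2F)))

    m≤x* : ∀ i → m i ≤ x* i
    m≤x* 0F = m≤M 0F
    m≤x* 1F = ≤-refl
    m≤x* 2F = 0≤⇒≤ (0≤* 0≤h* (<⇒≤ (0<m 2F)))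
      (solve 2 (λ h m → (:1 :+ h) :* m :- m := h :* m) ≈-refl h* (m 2F))
    m≤x* 3F = m≤M 3F

    0<x* : ∀ i → 0ℝ < x* i
    0<x* i = <-≤-trans (0<m i) (m≤x* i)

    x*≤M : ∀ i → x* i ≤ M i
    x*≤M 0F = ≤-refl
    x*≤M 1F = m≤M 1F
    x*≤M 2F = ≤-trans
      (0≤⇒≤ (0≤* 0≤k* (<⇒≤ (0<x* 2F)))
        (solve 2 (λ k x → (:1 :+ k) :* x :- x := k :* x) ≈-refl k* (x* 2F)))
      (≈⇒≤ [1+k*]x*≈M)
    x*≤M 3F = ≤-refl

    1*-≈ : ∀ x → 1ℝ * x ≈ x
    1*-≈ = solve 1 (λ x → :1 :* x := x) ≈-refl

    mean-y : mean (λ i → x* i ÷ m i [ 0<m i ]) ≈ z*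
    mean-y = ≈-trans
      (mean-cong₄ (λ i → x* i ÷ m i [ 0<m i ])
        ≈-refl (÷-unique (0<m 1F) (1*-≈ (m 1F))) (÷-unique (0<m 2F) ≈-refl) ≈-refl)
      (solve 4 (λ r₁ r₂ r₄ S →
        :¼ :* (r₁ :+ (:1 :+ ((:1 :+ (:½ :* (S :- ((r₁ :- :1) :- (r₂ :- :1) :+ (r₄ :- :1))) :- :1))
                 :+ (r₄ :+ :0))))
          := :⅛ :* (S :+ (r₁ :+ :1) :+ (r₂ :+ :1) :+ (r₄ :+ :1)))
        ≈-refl r₁ r₂ r₄ S)

    mean-u : mean (λ i → M i ÷ x* i [ 0<x* i ]) ≈ z*
    mean-u = ≈-trans
      (mean-cong₄ (λ i → M i ÷ x* i [ 0<x* i ])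
        (÷-unique (0<x* 0F) (1*-≈ (M 0F))) (÷-unique (0<x* 1F) (÷-* (0<m 1F)))
        (÷-unique (0<x* 2F) [1+k*]x*≈M) (÷-unique (0<x* 3F) (1*-≈ (M 3F))))
      (solve 4 (λ r₁ r₂ r₄ S →
        :¼ :* (:1 :+ (r₂ :+ ((:1 :+ (:½ :* (S :+ ((r₁ :- :1) :- (r₂ :- :1) :+ (r₄ :- :1))) :- :1))
                 :+ (:1 :+ :0))))
          := :⅛ :* (S :+ (r₁ :+ :1) :+ (r₂ :+ :1) :+ (r₄ :+ :1)))
        ≈-refl r₁ r₂ r₄ S)

    optimum : 𝒮
    optimum = record
      { x = x*
      ; m≤x = m≤x*
      ; x≤M = x*≤M
      ; balanced = ≈-trans mean-y (≈-sym mean-u)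
      }
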